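{- Let $p>3$ be a prime, let $a\in\mathbb{Z}_p$ with $a\not\equiv0\pmod p$, and let $\langle a\rangle_p$ be the least nonnegative residue of $a$ modulo $p$. Then $$\sum_{k=0}^{(p-1)/2}\binom ak\binom{ -1-a}k\frac1{2k-1}\equiv\begin{cases}-(2a+1)+2(a-\langle a\rangle_p)\big(1+(2a+1)E_{p-2}(-2a)\big)\pmod{p^2}&\text{if }\langle a\rangle_p<\frac p2,\\ 2a+1+2(p+a-\langle a\rangle_p)\big(1+(2a+1)E_{p-2}(-2a)\big)\pmod{p^2}&\text{if }\langle a\rangle_p>\frac p2.\end{cases}$$
   Context: $\mathbb{Z}_p$ denotes the set of rational numbers whose denominator is not divisible by $p$; congruences modulo $p^m$ are taken in $\mathbb{Z}_p$. For $a\in\mathbb{Z}_p$, $\langle a\rangle_p\in\{0,1,\dots,p-1\}$ satisfies $\langle a\rangle_p\equiv a\pmod p$. $\binom xk=x(x-1)\cdots(x-k+1)/k!$. The Euler numbers are defined by $E_0=1$, $E_n=-\sum_{k=1}^{[n/2]}\binom n{2k}E_{n-2k}$ ($n\ge1$), and the Euler polynomials by $E_n(x)=2^{ -n}\sum_{r=0}^n\binom nr(2x-1)^{n-r}E_r$. -}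

module Defs where

open import Data.Nat as ℕ using (ℕ; zero; suc)
open import Data.Nat.Divisibility using (_∣_)
open import Data.Nat.Combinatorics using (_C_)
open import Data.Nat using (_!)
open import Data.Nat.Properties using (_!≢0)
open import Data.Integer as ℤ using (ℤ; +_)
open import Data.Rational using (ℚ; 0ℚ; 1ℚ; ½; _+_; _*_; _-_; -_; _/_; ↧ₙ_)
open import Data.Product using (Σ; _×_)
open import Relation.Nullary using (¬_)
open import Relation.Binary.PropositionalEquality using (_≡_)

ℕ→ℚ : ℕ → ℚ
ℕ→ℚ n = + n / 1

_^ℚ_ : ℚ → ℕ → ℚ
x ^ℚ zero = 1ℚ
x ^ℚ suc n = x * (x ^ℚ n)

sumTo : ℕ → (ℕ → ℚ) → ℚ
sumTo zero f = f 0
sumTo (suc n) f = sumTo n f + f (suc n)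

sum1To : ℕ → (ℕ → ℚ) → ℚ
sum1To zero f = 0ℚ
sum1To (suc n) f = sum1To n f + f (suc n)

InZp : ℕ → ℚ → Set
InZp p x = ¬ (p ∣ ↧ₙ x)

CongMod : ℕ → ℕ → ℚ → ℚ → Set
CongMod p m x y = Σ ℚ (λ t → InZp p t × (x - y ≡ (ℕ→ℚ p ^ℚ m) * t))

fallFact : ℚ → ℕ → ℚ
fallFact x zero = 1ℚ
fallFact x (suc k) = fallFact x k * (x - ℕ→ℚ k)

binom : ℚ → ℕ → ℚ
binom x k = fallFact x k * ((+ 1 / (k !)) {{k !≢0}})

-- Euler numbers: E 0 = 1, E n = - Σ_{k=1}^{⌊n/2⌋} C(n,2k) E (n-2k).
-- Defined with a fuel argument; the fuel (suc n) is always sufficient since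
-- every recursive call is at an index strictly smaller than n.
eulerF : ℕ → ℕ → ℚ
eulerF zero n = 0ℚ
eulerF (suc f) zero = 1ℚ
eulerF (suc f) (suc n) =
  - sum1To (suc n ℕ./ 2) (λ k → ℕ→ℚ (suc n C (2 ℕ.* k)) * eulerF f (suc n ℕ.∸ 2 ℕ.* k))

euler : ℕ → ℚ
euler n = eulerF (suc n) n

eulerPoly : ℕ → ℚ → ℚ
eulerPoly n x = (½ ^ℚ n) *
  sumTo n (λ r → ℕ→ℚ (n C r) * (((ℕ→ℚ 2 * x) - 1ℚ) ^ℚ (n ℕ.∸ r)) * euler r)

inv2km1 : ℕ → ℚ
inv2km1 zero = - 1ℚ
inv2km1 (suc k) = + 1 / suc (2 ℕ.* k)

{-# OPTIONS --safe #-}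

-- Write S(a) for the sum and a = r + δ with p ∣ δ. It satisfies
--   (2a - 1) S(a) - (2a + 1) S(a - 1) = 2 ∏_{j ≤ (p-1)/2} (1 - a²/j²),
-- and a times this product is congruent to δ modulo p² when 0 ≤ r ≤ (p-1)/2.
-- As 2r - 1 is a p-adic unit for 1 ≤ r ≤ (p-1)/2, this determines S(r + δ) modulo p²
-- from S(δ) by induction on r. On the other side, E_n(x) + E_n(x+1) = 2xⁿ and Fermat's
-- little theorem give E_{p-2}(-2r) - E_{p-2}(-2r+2) ≡ 1/(r(2r - 1)) modulo p, which
-- matches the correction produced by the product. The same terms, summed over r, appear
-- in S(δ) ≡ -1 - δ Σ 1/(r(2r - 1)); since E_{p-2}(1-p) ≡ E_{p-2}(1) = -E_{p-2}(0), the
-- initial value is -1 + 2δ E_{p-2}(0). Residues r > p/2 are reduced to small ones by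
-- a ↦ -1 - a, which fixes S.

module Submission where

open import Defs
open import Data.Nat as ℕ using (ℕ; zero; suc; _∸_; _<_; _≤_; _/_; z≤n; s≤s; _!) renaming (_*_ to _*ℕ_; _+_ to _+ℕ_)
import Data.Nat.Properties as ℕₚ
import Data.Nat.DivMod as ℕ
import Data.Nat.Coprimality as C
open import Data.Nat.Combinatorics using (_C_; nCn≡1; nC1≡n; nCk≡nC[n∸k]; nCk+nC[k+1]≡[n+1]C[k+1]; k>n⇒nCk≡0)
open import Data.Nat.Divisibility as ℕ using (_∣_; divides)
open import Data.Nat.Primality as Prime using (Prime; euclidsLemma)
open import Data.Integer as ℤ using (ℤ) renaming (+_ to pos)
import Data.Integer.GCD as ℤ
import Data.Integer.Properties as ℤₚ
open import Data.Rational as ℚ using (ℚ; 0ℚ; 1ℚ; ½; mkℚ; _+_; _*_; _-_; -_; ↧ₙ_)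
import Data.Rational.Properties as ℚ
open import Data.Product using (Σ; _×_; _,_; proj₁; proj₂)
open import Data.Sum using (inj₁; inj₂; [_,_]′)
open import Data.List using (_∷_; [])
open import Function using (_∘_; const)
open import Level using (0ℓ)
open import Relation.Nullary using (¬_; contradiction)
open import Relation.Nullary.Decidable using (dec⇒maybe)
open import Relation.Binary.PropositionalEquality
open import Tactic.RingSolver using (solve; solve-∀)
open import Tactic.RingSolver.Core.AlmostCommutativeRing using (AlmostCommutativeRing; fromCommutativeRing)

open ≡-Reasoning

-- Modulo p² the Euler polynomial enters only with a factor divisible by p, so its values matter
-- only modulo p. There x^(p-2) acts as 1/x, and the partial fractions 1/(r(2r - 1)) = 2(1/(2r - 1)
-- - 1/(2r)) become differences of powers that the shift rule for E_{p-2} produces. The obstacle is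
-- the middle of the residue range: at r = (p+1)/2 the factor 2r - 1 equals p, so the induction
-- cannot pass from small to large residues. This is what forces the reflection. In the inductions
-- modulo p² on r the unknown difference is multiplied not by a unit u but by u + e with p dividing
-- e. Each such step is an exact polynomial identity, with denominators cleared, whose right side
-- visibly lies in the ideal p²ℤₚ; the factor u + e is cancelled at the end. The only fact about
-- Euler polynomials drawn from their definition, besides integrality and continuity modulo p, is
-- the shift rule; even the reflection formula is recovered from it at the points needed.

ring : AlmostCommutativeRing 0ℓ 0ℓ
ring = fromCommutativeRing ℚ.+-*-commutativeRing (λ x → dec⇒maybe (0ℚ ℚ.≟ x))

-- Numerals, reciprocals and powers in ℚ

2ℚ : ℚ
2ℚ = ℕ→ℚ 2

ℕ→ℚ≡mkℚ : ∀ n → ℕ→ℚ n ≡ mkℚ (pos n) 0 (C.sym (C.1-coprimeTo n))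
ℕ→ℚ≡mkℚ n = ℚ.normalize-coprime (C.sym (C.1-coprimeTo n))

ℕ→ℚ-+ : ∀ m n → ℕ→ℚ (m +ℕ n) ≡ ℕ→ℚ m + ℕ→ℚ n
ℕ→ℚ-+ m n = sym (begin
  ℕ→ℚ m + ℕ→ℚ n                            ≡⟨ cong₂ _+_ (ℕ→ℚ≡mkℚ m) (ℕ→ℚ≡mkℚ n) ⟩
  (pos m ℤ.* pos 1 ℤ.+ pos n ℤ.* pos 1) ℚ./ 1      ≡⟨ cong (ℚ._/ 1) (cong₂ ℤ._+_ (ℤₚ.*-identityʳ (pos m)) (ℤₚ.*-identityʳ (pos n))) ⟩
  ℕ→ℚ (m +ℕ n)                             ∎)

ℕ→ℚ-* : ∀ m n → ℕ→ℚ (m *ℕ n) ≡ ℕ→ℚ m * ℕ→ℚ n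
ℕ→ℚ-* m n = sym (begin
  ℕ→ℚ m * ℕ→ℚ n                   ≡⟨ cong₂ _*_ (ℕ→ℚ≡mkℚ m) (ℕ→ℚ≡mkℚ n) ⟩
  (pos m ℤ.* pos n) ℚ./ 1             ≡⟨ cong (ℚ._/ 1) (ℤₚ.pos-* m n) ⟨
  ℕ→ℚ (m *ℕ n)                    ∎)

ℕ→ℚ-suc : ∀ n → ℕ→ℚ (suc n) ≡ 1ℚ + ℕ→ℚ n
ℕ→ℚ-suc = ℕ→ℚ-+ 1

1/suc≡mkℚ : ∀ n → pos 1 ℚ./ suc n ≡ mkℚ (pos 1) n (C.1-coprimeTo (suc n))
1/suc≡mkℚ n = ℚ.normalize-coprime (C.1-coprimeTo (suc n))

*-1/ : ∀ n .{{_ : ℕ.NonZero n}} → ℕ→ℚ n * (pos 1 ℚ./ n) ≡ 1ℚ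
*-1/ (suc n) = trans (cong₂ _*_ (ℕ→ℚ≡mkℚ (suc n)) (1/suc≡mkℚ n))
  (ℚ.*-inverseʳ (mkℚ (pos (suc n)) 0 (C.sym (C.1-coprimeTo (suc n)))))

inverse-unique : ∀ u {v w} → u * v ≡ 1ℚ → u * w ≡ 1ℚ → v ≡ w
inverse-unique u {v} {w} uv uw = begin
  v            ≡⟨ ℚ.*-identityʳ v ⟨
  v * 1ℚ       ≡⟨ cong (v *_) uw ⟨
  v * (u * w)  ≡⟨ solve (u ∷ v ∷ w ∷ []) ring ⟩
  (u * v) * w  ≡⟨ cong (_* w) uv ⟩
  1ℚ * w       ≡⟨ ℚ.*-identityˡ w ⟩
  w            ∎

-- Both sides are inverse to m n, so uniqueness of inverses replaces any computation with normalised
-- fractions.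
1/-* : ∀ m n .{{_ : ℕ.NonZero m}} .{{_ : ℕ.NonZero n}} .{{_ : ℕ.NonZero (m *ℕ n)}} →
       pos 1 ℚ./ (m *ℕ n) ≡ (pos 1 ℚ./ m) * (pos 1 ℚ./ n)
1/-* m n = inverse-unique (ℕ→ℚ (m *ℕ n)) (*-1/ (m *ℕ n)) (begin
  ℕ→ℚ (m *ℕ n) * ((pos 1 ℚ./ m) * (pos 1 ℚ./ n))             ≡⟨ cong (_* ((pos 1 ℚ./ m) * (pos 1 ℚ./ n))) (ℕ→ℚ-* m n) ⟩
  ℕ→ℚ m * ℕ→ℚ n * ((pos 1 ℚ./ m) * (pos 1 ℚ./ n))            ≡⟨ interchange (ℕ→ℚ m) (ℕ→ℚ n) (pos 1 ℚ./ m) (pos 1 ℚ./ n) ⟩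
  (ℕ→ℚ m * (pos 1 ℚ./ m)) * (ℕ→ℚ n * (pos 1 ℚ./ n))          ≡⟨ cong₂ _*_ (*-1/ m) (*-1/ n) ⟩
  1ℚ                                                     ∎)
  where
  interchange : ∀ w x y z → w * x * (y * z) ≡ (w * y) * (x * z)
  interchange = solve-∀ ring

^ℚ-*-distrib : ∀ x y n → (x * y) ^ℚ n ≡ (x ^ℚ n) * (y ^ℚ n)
^ℚ-*-distrib x y zero = refl
^ℚ-*-distrib x y (suc n) = begin
  x * y * ((x * y) ^ℚ n)           ≡⟨ cong (x * y *_) (^ℚ-*-distrib x y n) ⟩
  x * y * ((x ^ℚ n) * (y ^ℚ n))    ≡⟨ shuffle x y (x ^ℚ n) (y ^ℚ n) ⟩
  x * (x ^ℚ n) * (y * (y ^ℚ n))    ∎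
  where
  shuffle : ∀ w x y z → w * x * (y * z) ≡ (w * y) * (x * z)
  shuffle = solve-∀ ring

1^ℚ : ∀ n → 1ℚ ^ℚ n ≡ 1ℚ
1^ℚ zero = refl
1^ℚ (suc n) = trans (ℚ.*-identityˡ _) (1^ℚ n)

-- Finite sums

sumTo-cong : ∀ n {f g : ℕ → ℚ} → (∀ {j} → j ≤ n → f j ≡ g j) → sumTo n f ≡ sumTo n g
sumTo-cong zero eq = eq z≤n
sumTo-cong (suc n) eq = cong₂ _+_ (sumTo-cong n (λ j≤n → eq (ℕₚ.m≤n⇒m≤1+n j≤n))) (eq ℕₚ.≤-refl)

sum1To-cong : ∀ n {f g : ℕ → ℚ} → (∀ j → f (suc j) ≡ g (suc j)) → sum1To n f ≡ sum1To n g
sum1To-cong zero eq = refl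
sum1To-cong (suc n) eq = cong₂ _+_ (sum1To-cong n eq) (eq n)

sumTo-+ : ∀ n (f g : ℕ → ℚ) → sumTo n (λ j → f j + g j) ≡ sumTo n f + sumTo n g
sumTo-+ zero f g = refl
sumTo-+ (suc n) f g = begin
  sumTo n (λ j → f j + g j) + (f (suc n) + g (suc n))  ≡⟨ cong (_+ (f (suc n) + g (suc n))) (sumTo-+ n f g) ⟩
  sumTo n f + sumTo n g + (f (suc n) + g (suc n))      ≡⟨ interchange (sumTo n f) (sumTo n g) (f (suc n)) (g (suc n)) ⟩
  sumTo n f + f (suc n) + (sumTo n g + g (suc n))      ∎
  where
  interchange : ∀ w x y z → w + x + (y + z) ≡ w + y + (x + z)
  interchange = solve-∀ ring

sumTo-*ˡ : ∀ n y (f : ℕ → ℚ) → sumTo n (λ j → y * f j) ≡ y * sumTo n f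
sumTo-*ˡ zero y f = refl
sumTo-*ˡ (suc n) y f = trans (cong (_+ y * f (suc n)) (sumTo-*ˡ n y f)) (sym (ℚ.*-distribˡ-+ y _ _))

sumTo-head : ∀ n (f : ℕ → ℚ) → sumTo (suc n) f ≡ f 0 + sumTo n (f ∘ suc)
sumTo-head zero f = refl
sumTo-head (suc n) f = trans (cong (_+ f (suc (suc n))) (sumTo-head n f)) (ℚ.+-assoc (f 0) _ _)

sumTo-reverse : ∀ n (f : ℕ → ℚ) → sumTo n f ≡ sumTo n (λ j → f (n ∸ j))
sumTo-reverse zero f = refl
sumTo-reverse (suc n) f = begin
  sumTo n f + f (suc n)                        ≡⟨ cong (_+ f (suc n)) (sumTo-reverse n f) ⟩
  sumTo n (λ j → f (n ∸ j)) + f (suc n)        ≡⟨ ℚ.+-comm _ (f (suc n)) ⟩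
  f (suc n) + sumTo n (λ j → f (n ∸ j))        ≡⟨ sumTo-head n (λ j → f (suc n ∸ j)) ⟨
  sumTo (suc n) (λ j → f (suc n ∸ j))          ∎

-- Parity and sums over even indices

-1^ℚ-even : ∀ k → (- 1ℚ) ^ℚ (2 *ℕ k) ≡ 1ℚ
-1^ℚ-even zero = refl
-1^ℚ-even (suc k) = begin
  (- 1ℚ) ^ℚ (2 *ℕ suc k)                 ≡⟨ cong ((- 1ℚ) ^ℚ_) (ℕₚ.*-suc 2 k) ⟩
  - 1ℚ * (- 1ℚ * ((- 1ℚ) ^ℚ (2 *ℕ k)))   ≡⟨ cancel ((- 1ℚ) ^ℚ (2 *ℕ k)) ⟩
  (- 1ℚ) ^ℚ (2 *ℕ k)                     ≡⟨ -1^ℚ-even k ⟩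
  1ℚ                                     ∎
  where
  cancel : ∀ x → - 1ℚ * (- 1ℚ * x) ≡ x
  cancel = solve-∀ ring

data Half : ℕ → Set where
  even : ∀ k → Half (2 *ℕ k)
  odd  : ∀ k → Half (suc (2 *ℕ k))

half : ∀ n → Half n
half zero = even 0
half (suc n) with half n
... | even k = odd k
... | odd k  = subst Half (ℕₚ.*-suc 2 k) (even (suc k))

2*k/2≡k : ∀ k → 2 *ℕ k / 2 ≡ k
2*k/2≡k k = trans (cong (_/ 2) (ℕₚ.*-comm 2 k)) (ℕ.m*n/n≡m k 2)

[1+2*k]/2≡k : ∀ k → suc (2 *ℕ k) / 2 ≡ k
[1+2*k]/2≡k k = begin
  (1 +ℕ 2 *ℕ k) / 2       ≡⟨ ℕ.+-distrib-/-∣ʳ 1 (ℕ.m∣m*n {2} k) ⟩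
  1 / 2 +ℕ 2 *ℕ k / 2     ≡⟨ 2*k/2≡k k ⟩
  k                       ∎

module _ (F : ℕ → ℚ) where
  private
    signed : ℕ → ℚ
    signed j = (1ℚ ^ℚ j + (- 1ℚ) ^ℚ j) * F j

    signed-even : ∀ k → signed (2 *ℕ k) ≡ 2ℚ * F (2 *ℕ k)
    signed-even k = cong (_* F (2 *ℕ k)) (cong₂ _+_ (1^ℚ (2 *ℕ k)) (-1^ℚ-even k))

    signed-odd : ∀ k → signed (suc (2 *ℕ k)) ≡ 0ℚ
    signed-odd k = trans
      (cong (_* F (suc (2 *ℕ k))) (cong₂ _+_ (1^ℚ (suc (2 *ℕ k))) (cong (- 1ℚ *_) (-1^ℚ-even k))))
      (ℚ.*-zeroˡ (F (suc (2 *ℕ k))))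

    upTo-even : ∀ k → sumTo (2 *ℕ k) signed ≡ 2ℚ * (F 0 + sum1To k (λ i → F (2 *ℕ i)))
    upTo-odd : ∀ k → sumTo (suc (2 *ℕ k)) signed ≡ 2ℚ * (F 0 + sum1To k (λ i → F (2 *ℕ i)))

    upTo-even zero = cong (2ℚ *_) (sym (ℚ.+-identityʳ (F 0)))
    upTo-even (suc k) = begin
      sumTo (2 *ℕ suc k) signed
        ≡⟨ cong (λ n → sumTo n signed) (ℕₚ.*-suc 2 k) ⟩
      sumTo (suc (2 *ℕ k)) signed + signed (2 +ℕ 2 *ℕ k)
        ≡⟨ cong₂ _+_ (upTo-odd k) (trans (cong signed (sym (ℕₚ.*-suc 2 k))) (signed-even (suc k))) ⟩
      2ℚ * (F 0 + sum1To k (λ i → F (2 *ℕ i))) + 2ℚ * F (2 *ℕ suc k)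
        ≡⟨ regroup (F 0) (sum1To k (λ i → F (2 *ℕ i))) (F (2 *ℕ suc k)) ⟩
      2ℚ * (F 0 + (sum1To k (λ i → F (2 *ℕ i)) + F (2 *ℕ suc k)))  ∎
      where
      regroup : ∀ x y z → 2ℚ * (x + y) + 2ℚ * z ≡ 2ℚ * (x + (y + z))
      regroup = solve-∀ ring
    upTo-odd k = trans (cong₂ _+_ (upTo-even k) (signed-odd k)) (ℚ.+-identityʳ _)

  -- The weight 1 + (-1)^j is 2 at even j and 0 at odd j. This links the recurrence of the Euler
  -- numbers, a sum over even indices, to binomial sums at 1 and -1. The term at 0 stands apart
  -- because `sum1To` starts at 1.
  sumTo-signed : ∀ n → sumTo n (λ j → (1ℚ ^ℚ j + (- 1ℚ) ^ℚ j) * F j)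
                       ≡ 2ℚ * (F 0 + sum1To (n / 2) (λ i → F (2 *ℕ i)))
  sumTo-signed n with half n
  ... | even k = trans (upTo-even k) (cong (λ h → 2ℚ * (F 0 + sum1To h (λ i → F (2 *ℕ i)))) (sym (2*k/2≡k k)))
  ... | odd k  = trans (upTo-odd k) (cong (λ h → 2ℚ * (F 0 + sum1To h (λ i → F (2 *ℕ i)))) (sym ([1+2*k]/2≡k k)))

-- Umbral calculus and Euler polynomials

-- The umbral power (y + c)ⁿ, where cᵏ stands for c k.
umbral : ℚ → ℕ → (ℕ → ℚ) → ℚ
umbral y zero    c = c 0
umbral y (suc n) c = y * umbral y n c + umbral y n (c ∘ suc)

umbral-cong : ∀ y n {c d : ℕ → ℚ} → (∀ k → c k ≡ d k) → umbral y n c ≡ umbral y n d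
umbral-cong y zero    c≡d = c≡d 0
umbral-cong y (suc n) c≡d = cong₂ _+_ (cong (y *_) (umbral-cong y n c≡d)) (umbral-cong y n (c≡d ∘ suc))

umbral-linear : ∀ y n h (c d : ℕ → ℚ) → umbral y n (λ k → h * c k + d k) ≡ h * umbral y n c + umbral y n d
umbral-linear y zero    h c d = refl
umbral-linear y (suc n) h c d = begin
  y * umbral y n (λ k → h * c k + d k) + umbral y n (λ k → h * c (suc k) + d (suc k))
    ≡⟨ cong₂ (λ s t → y * s + t) (umbral-linear y n h c d) (umbral-linear y n h (c ∘ suc) (d ∘ suc)) ⟩
  y * (h * umbral y n c + umbral y n d) + (h * umbral y n (c ∘ suc) + umbral y n (d ∘ suc))
    ≡⟨ regroup y h (umbral y n c) (umbral y n d) (umbral y n (c ∘ suc)) (umbral y n (d ∘ suc)) ⟩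
  h * (y * umbral y n c + umbral y n (c ∘ suc)) + (y * umbral y n d + umbral y n (d ∘ suc))  ∎
  where
  regroup : ∀ y h a b c d → y * (h * a + b) + (h * c + d) ≡ h * (y * a + c) + (y * b + d)
  regroup = solve-∀ ring

umbral-+ : ∀ y n (c d : ℕ → ℚ) → umbral y n (λ k → c k + d k) ≡ umbral y n c + umbral y n d
umbral-+ y n c d = begin
  umbral y n (λ k → c k + d k)         ≡⟨ umbral-cong y n (λ k → cong (_+ d k) (sym (ℚ.*-identityˡ (c k)))) ⟩
  umbral y n (λ k → 1ℚ * c k + d k)    ≡⟨ umbral-linear y n 1ℚ c d ⟩
  1ℚ * umbral y n c + umbral y n d     ≡⟨ cong (_+ umbral y n d) (ℚ.*-identityˡ (umbral y n c)) ⟩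
  umbral y n c + umbral y n d          ∎

-- Associativity in umbral form: the sequence of umbral powers of h + c is itself an umbra standing
-- for h + c, and y + (h + c) = (y + h) + c.
umbral-umbral : ∀ y h n c → umbral y n (λ k → umbral h k c) ≡ umbral (y + h) n c
umbral-umbral y h zero    c = refl
umbral-umbral y h (suc n) c = begin
  y * umbral y n (λ k → umbral h k c) + umbral y n (λ k → h * umbral h k c + umbral h k (c ∘ suc))
    ≡⟨ cong (y * umbral y n (λ k → umbral h k c) +_) (umbral-linear y n h (λ k → umbral h k c) (λ k → umbral h k (c ∘ suc))) ⟩
  y * umbral y n (λ k → umbral h k c) + (h * umbral y n (λ k → umbral h k c) + umbral y n (λ k → umbral h k (c ∘ suc)))
    ≡⟨ cong₂ (λ s t → y * s + (h * s + t)) (umbral-umbral y h n c) (umbral-umbral y h n (c ∘ suc)) ⟩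
  y * umbral (y + h) n c + (h * umbral (y + h) n c + umbral (y + h) n (c ∘ suc))
    ≡⟨ collect y h (umbral (y + h) n c) (umbral (y + h) n (c ∘ suc)) ⟩
  (y + h) * umbral (y + h) n c + umbral (y + h) n (c ∘ suc)  ∎
  where
  collect : ∀ y h s t → y * s + (h * s + t) ≡ (y + h) * s + t
  collect = solve-∀ ring

umbral-0 : ∀ y n {c} → (∀ k → c k ≡ 0ℚ) → umbral y n c ≡ 0ℚ
umbral-0 y zero    c≡0 = c≡0 0
umbral-0 y (suc n) c≡0 =
  trans (cong₂ (λ s t → y * s + t) (umbral-0 y n c≡0) (umbral-0 y n (c≡0 ∘ suc)))
        (cong (_+ 0ℚ) (ℚ.*-zeroʳ y))

umbral-δ : ∀ y n {c} → (∀ k → c (suc k) ≡ 0ℚ) → umbral y n c ≡ (y ^ℚ n) * c 0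
umbral-δ y zero    {c} c≡0 = sym (ℚ.*-identityˡ (c 0))
umbral-δ y (suc n) {c} c≡0 = begin
  y * umbral y n c + umbral y n (c ∘ suc)  ≡⟨ cong₂ (λ s t → y * s + t) (umbral-δ y n c≡0) (umbral-0 y n c≡0) ⟩
  y * ((y ^ℚ n) * c 0) + 0ℚ                ≡⟨ drop y (y ^ℚ n) (c 0) ⟩
  y * (y ^ℚ n) * c 0                       ∎
  where
  drop : ∀ y z c → y * (z * c) + 0ℚ ≡ y * z * c
  drop = solve-∀ ring

umbral-1 : ∀ y n → umbral y n (const 1ℚ) ≡ (y + 1ℚ) ^ℚ n
umbral-1 y zero    = refl
umbral-1 y (suc n) = trans (cong (λ s → y * s + s) (umbral-1 y n)) (collect y ((y + 1ℚ) ^ℚ n))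
  where
  collect : ∀ y s → y * s + s ≡ (y + 1ℚ) * s
  collect = solve-∀ ring

umbral≡sum : ∀ y n c → umbral y n c ≡ sumTo n (λ j → ℕ→ℚ (n C j) * (y ^ℚ (n ∸ j)) * c j)
umbral≡sum y zero    c = sym (ℚ.*-identityˡ (c 0))
umbral≡sum y (suc n) c = sym (begin
  sumTo (suc n) (λ j → ℕ→ℚ (suc n C j) * (y ^ℚ (suc n ∸ j)) * c j)
    ≡⟨ sumTo-head n _ ⟩
  first + sumTo n (λ j → ℕ→ℚ (suc n C suc j) * (y ^ℚ (n ∸ j)) * c (suc j))
    ≡⟨ cong (first +_) (trans (sumTo-cong n (λ {j} _ → pascal j)) (sumTo-+ n _ _)) ⟩
  first + (sumTo n (λ j → ℕ→ℚ (n C j) * (y ^ℚ (n ∸ j)) * c (suc j)) + tail)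
    ≡⟨ rotate first _ tail ⟩
  first + tail + sumTo n (λ j → ℕ→ℚ (n C j) * (y ^ℚ (n ∸ j)) * c (suc j))
    ≡⟨ cong₂ _+_ (sumTo-head n raised) (umbral≡sum y n (c ∘ suc)) ⟨
  sumTo n raised + raised (suc n) + umbral y n (c ∘ suc)
    ≡⟨ cong (_+ umbral y n (c ∘ suc)) (cong₂ _+_ (trans (sumTo-cong n factor) (sumTo-*ˡ n y _)) last≡0) ⟩
  y * sumTo n (λ j → ℕ→ℚ (n C j) * (y ^ℚ (n ∸ j)) * c j) + 0ℚ + umbral y n (c ∘ suc)
    ≡⟨ cong (_+ umbral y n (c ∘ suc)) (ℚ.+-identityʳ (y * sumTo n (λ j → ℕ→ℚ (n C j) * (y ^ℚ (n ∸ j)) * c j))) ⟩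
  y * sumTo n (λ j → ℕ→ℚ (n C j) * (y ^ℚ (n ∸ j)) * c j) + umbral y n (c ∘ suc)
    ≡⟨ cong (λ s → y * s + umbral y n (c ∘ suc)) (umbral≡sum y n c) ⟨
  y * umbral y n c + umbral y n (c ∘ suc)  ∎)
  where
  raised : ℕ → ℚ
  raised j = ℕ→ℚ (n C j) * (y ^ℚ (suc n ∸ j)) * c j

  first tail : ℚ
  first = raised 0
  tail  = sumTo n (raised ∘ suc)

  distrib : ∀ a b z w → (a + b) * z * w ≡ a * z * w + b * z * w
  distrib = solve-∀ ring

  pascal : ∀ j → ℕ→ℚ (suc n C suc j) * (y ^ℚ (n ∸ j)) * c (suc j)
                 ≡ ℕ→ℚ (n C j) * (y ^ℚ (n ∸ j)) * c (suc j) + raised (suc j)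
  pascal j = begin
    ℕ→ℚ (suc n C suc j) * (y ^ℚ (n ∸ j)) * c (suc j)
      ≡⟨ cong (λ b → b * (y ^ℚ (n ∸ j)) * c (suc j))
           (trans (cong ℕ→ℚ (sym (nCk+nC[k+1]≡[n+1]C[k+1] n j))) (ℕ→ℚ-+ (n C j) (n C suc j))) ⟩
    (ℕ→ℚ (n C j) + ℕ→ℚ (n C suc j)) * (y ^ℚ (n ∸ j)) * c (suc j)
      ≡⟨ distrib (ℕ→ℚ (n C j)) (ℕ→ℚ (n C suc j)) (y ^ℚ (n ∸ j)) (c (suc j)) ⟩
    ℕ→ℚ (n C j) * (y ^ℚ (n ∸ j)) * c (suc j) + raised (suc j)  ∎

  rotate : ∀ x s t → x + (s + t) ≡ x + t + s
  rotate = solve-∀ ring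

  pull : ∀ b y z w → b * (y * z) * w ≡ y * (b * z * w)
  pull = solve-∀ ring

  factor : ∀ {j} → j ≤ n → raised j ≡ y * (ℕ→ℚ (n C j) * (y ^ℚ (n ∸ j)) * c j)
  factor {j} j≤n = trans (cong (λ e → ℕ→ℚ (n C j) * (y ^ℚ e) * c j) (ℕₚ.+-∸-assoc 1 j≤n))
                         (pull (ℕ→ℚ (n C j)) y (y ^ℚ (n ∸ j)) (c j))

  -- `tail` runs up to the index n + 1, one beyond the range of the expansion of degree n; the
  -- surplus term carries C(n, n+1) = 0.
  last≡0 : raised (suc n) ≡ 0ℚ
  last≡0 = begin
    ℕ→ℚ (n C suc n) * (y ^ℚ (n ∸ n)) * c (suc n)  ≡⟨ cong (λ b → ℕ→ℚ b * (y ^ℚ (n ∸ n)) * c (suc n)) (k>n⇒nCk≡0 (ℕₚ.n<1+n n)) ⟩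
    0ℚ * (y ^ℚ (n ∸ n)) * c (suc n)               ≡⟨ cong (_* c (suc n)) (ℚ.*-zeroˡ (y ^ℚ (n ∸ n))) ⟩
    0ℚ * c (suc n)                                ≡⟨ ℚ.*-zeroˡ (c (suc n)) ⟩
    0ℚ                                            ∎

-- The order that matches the defining recurrence of the Euler numbers, where C(n, 2k) multiplies
-- the number of index n - 2k.
umbral≡sum-reversed : ∀ y n c → umbral y n c ≡ sumTo n (λ j → (y ^ℚ j) * (ℕ→ℚ (n C j) * c (n ∸ j)))
umbral≡sum-reversed y n c = begin
  umbral y n c                                                              ≡⟨ umbral≡sum y n c ⟩
  sumTo n (λ j → ℕ→ℚ (n C j) * (y ^ℚ (n ∸ j)) * c j)                        ≡⟨ sumTo-reverse n _ ⟩
  sumTo n (λ j → ℕ→ℚ (n C (n ∸ j)) * (y ^ℚ (n ∸ (n ∸ j))) * c (n ∸ j))      ≡⟨ sumTo-cong n flip ⟩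
  sumTo n (λ j → (y ^ℚ j) * (ℕ→ℚ (n C j) * c (n ∸ j)))                      ∎
  where
  swap : ∀ x y z → x * y * z ≡ y * (x * z)
  swap = solve-∀ ring

  flip : ∀ {j} → j ≤ n → ℕ→ℚ (n C (n ∸ j)) * (y ^ℚ (n ∸ (n ∸ j))) * c (n ∸ j) ≡ (y ^ℚ j) * (ℕ→ℚ (n C j) * c (n ∸ j))
  flip {j} j≤n = trans
    (cong₂ (λ b i → ℕ→ℚ b * (y ^ℚ i) * c (n ∸ j)) (sym (nCk≡nC[n∸k] j≤n)) (ℕₚ.m∸[m∸n]≡n j≤n))
    (swap (ℕ→ℚ (n C j)) (y ^ℚ j) (c (n ∸ j)))

-- Euler numbers and the shift rule for Euler polynomials

eulerF-fuel : ∀ f g n → n < f → n < g → eulerF f n ≡ eulerF g n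
eulerF-fuel (suc f) (suc g) zero    n<f n<g = refl
eulerF-fuel (suc f) (suc g) (suc n) (s≤s n<f) (s≤s n<g) = cong -_ (sum1To-cong (suc n / 2) (λ k →
  cong (ℕ→ℚ (suc n C (2 *ℕ suc k)) *_) (eulerF-fuel f g (suc n ∸ 2 *ℕ suc k)
    (ℕₚ.≤-<-trans (ℕₚ.m∸n≤m n (k +ℕ 1 *ℕ suc k)) n<f) (ℕₚ.≤-<-trans (ℕₚ.m∸n≤m n (k +ℕ 1 *ℕ suc k)) n<g))))

-- The recursive calls run with fuel n + 1, whereas `euler` at a smaller index brings its own. The
-- sum starts at k = 1, so the index drops strictly and either amount is sufficient.
euler-suc : ∀ n → euler (suc n) ≡ - sum1To (suc n / 2) (λ k → ℕ→ℚ (suc n C (2 *ℕ k)) * euler (suc n ∸ 2 *ℕ k))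
euler-suc n = cong -_ (sum1To-cong (suc n / 2) (λ k →
  cong (ℕ→ℚ (suc n C (2 *ℕ suc k)) *_) (eulerF-fuel (suc n) (suc (n ∸ (k +ℕ suc (k +ℕ 0)))) (suc n ∸ 2 *ℕ suc k)
    (s≤s (ℕₚ.m∸n≤m n (k +ℕ 1 *ℕ suc k))) (ℕₚ.n<1+n _))))

euler-even-sum : ∀ n → ℕ→ℚ (suc n C 0) * euler (suc n)
                       + sum1To (suc n / 2) (λ k → ℕ→ℚ (suc n C (2 *ℕ k)) * euler (suc n ∸ 2 *ℕ k)) ≡ 0ℚ
euler-even-sum n = begin
  1ℚ * euler (suc n) + rest   ≡⟨ cong (_+ rest) (trans (ℚ.*-identityˡ (euler (suc n))) (euler-suc n)) ⟩
  - rest + rest               ≡⟨ ℚ.+-inverseˡ rest ⟩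
  0ℚ                          ∎
  where
  rest : ℚ
  rest = sum1To (suc n / 2) (λ k → ℕ→ℚ (suc n C (2 *ℕ k)) * euler (suc n ∸ 2 *ℕ k))

umbral-±1-euler : ∀ n → umbral 1ℚ n euler + umbral (- 1ℚ) n euler
                        ≡ 2ℚ * (ℕ→ℚ (n C 0) * euler n + sum1To (n / 2) (λ k → ℕ→ℚ (n C (2 *ℕ k)) * euler (n ∸ 2 *ℕ k)))
umbral-±1-euler n = begin
  umbral 1ℚ n euler + umbral (- 1ℚ) n euler
    ≡⟨ cong₂ _+_ (umbral≡sum-reversed 1ℚ n euler) (umbral≡sum-reversed (- 1ℚ) n euler) ⟩
  sumTo n (λ j → (1ℚ ^ℚ j) * F j) + sumTo n (λ j → ((- 1ℚ) ^ℚ j) * F j)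
    ≡⟨ sumTo-+ n _ _ ⟨
  sumTo n (λ j → (1ℚ ^ℚ j) * F j + ((- 1ℚ) ^ℚ j) * F j)
    ≡⟨ sumTo-cong n (λ {j} _ → ℚ.*-distribʳ-+ (F j) (1ℚ ^ℚ j) ((- 1ℚ) ^ℚ j)) ⟨
  sumTo n (λ j → ((1ℚ ^ℚ j) + ((- 1ℚ) ^ℚ j)) * F j)
    ≡⟨ sumTo-signed F n ⟩
  2ℚ * (F 0 + sum1To (n / 2) (λ k → F (2 *ℕ k)))  ∎
  where
  F : ℕ → ℚ
  F j = ℕ→ℚ (n C j) * euler (n ∸ j)

-- Moving the shifts by 1 and -1 into the umbra leaves the sequence (1 + E)^k + (-1 + E)^k. By the
-- recurrence of the Euler numbers it is 2 at k = 0 and vanishes afterwards, so only the leading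
-- term in y survives.
umbral-euler-sum : ∀ y n → umbral (y + 1ℚ) n euler + umbral (y - 1ℚ) n euler ≡ (y ^ℚ n) * 2ℚ
umbral-euler-sum y n = begin
  umbral (y + 1ℚ) n euler + umbral (y - 1ℚ) n euler
    ≡⟨ cong₂ _+_ (umbral-umbral y 1ℚ n euler) (umbral-umbral y (- 1ℚ) n euler) ⟨
  umbral y n (λ k → umbral 1ℚ k euler) + umbral y n (λ k → umbral (- 1ℚ) k euler)
    ≡⟨ umbral-+ y n _ _ ⟨
  umbral y n (λ k → umbral 1ℚ k euler + umbral (- 1ℚ) k euler)
    ≡⟨ umbral-δ y n (λ k → trans (umbral-±1-euler (suc k)) (cong (2ℚ *_) (euler-even-sum k))) ⟩
  (y ^ℚ n) * 2ℚ  ∎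

½^-*-2^ : ∀ x n → (½ ^ℚ n) * ((2ℚ * x) ^ℚ n) ≡ x ^ℚ n
½^-*-2^ x n = trans (sym (^ℚ-*-distrib ½ (2ℚ * x) n)) (cong (_^ℚ n) (cancel x))
  where
  cancel : ∀ x → ½ * (2ℚ * x) ≡ x
  cancel = solve-∀ ring

eulerPoly≡umbral : ∀ n x → eulerPoly n x ≡ (½ ^ℚ n) * umbral (2ℚ * x - 1ℚ) n euler
eulerPoly≡umbral n x = cong ((½ ^ℚ n) *_) (sym (umbral≡sum (2ℚ * x - 1ℚ) n euler))

eulerPoly-+-shift : ∀ n x → eulerPoly n x + eulerPoly n (1ℚ + x) ≡ 2ℚ * (x ^ℚ n)
eulerPoly-+-shift n x = begin
  eulerPoly n x + eulerPoly n (1ℚ + x)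
    ≡⟨ cong₂ _+_ (eulerPoly≡umbral n x) (eulerPoly≡umbral n (1ℚ + x)) ⟩
  (½ ^ℚ n) * umbral (2ℚ * x - 1ℚ) n euler + (½ ^ℚ n) * umbral (2ℚ * (1ℚ + x) - 1ℚ) n euler
    ≡⟨ cong (λ z → (½ ^ℚ n) * umbral (2ℚ * x - 1ℚ) n euler + (½ ^ℚ n) * umbral z n euler) (shift x) ⟩
  (½ ^ℚ n) * umbral (2ℚ * x - 1ℚ) n euler + (½ ^ℚ n) * umbral (2ℚ * x + 1ℚ) n euler
    ≡⟨ collect (½ ^ℚ n) (umbral (2ℚ * x - 1ℚ) n euler) (umbral (2ℚ * x + 1ℚ) n euler) ⟩
  (½ ^ℚ n) * (umbral (2ℚ * x + 1ℚ) n euler + umbral (2ℚ * x - 1ℚ) n euler)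
    ≡⟨ cong ((½ ^ℚ n) *_) (umbral-euler-sum (2ℚ * x) n) ⟩
  (½ ^ℚ n) * (((2ℚ * x) ^ℚ n) * 2ℚ)
    ≡⟨ rotate (½ ^ℚ n) ((2ℚ * x) ^ℚ n) 2ℚ ⟩
  2ℚ * ((½ ^ℚ n) * ((2ℚ * x) ^ℚ n))
    ≡⟨ cong (2ℚ *_) (½^-*-2^ x n) ⟩
  2ℚ * (x ^ℚ n)  ∎
  where
  shift : ∀ x → 2ℚ * (1ℚ + x) - 1ℚ ≡ 2ℚ * x + 1ℚ
  shift = solve-∀ ring
  collect : ∀ h a b → h * a + h * b ≡ h * (b + a)
  collect = solve-∀ ring
  rotate : ∀ h a b → h * (a * b) ≡ b * (h * a)
  rotate = solve-∀ ring

-- p-integral rationals and the ideals pᵐℤₚ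

-- For n + 1 = p this exhibits the factor p of C(p, j+1), without dividing by j + 1.
absorption : ∀ n j → suc j *ℕ (suc n C suc j) ≡ suc n *ℕ (n C j)
absorption zero    zero    = refl
absorption zero    (suc j) = trans (cong (suc (suc j) *ℕ_) (k>n⇒nCk≡0 {1} {suc (suc j)} (s≤s (s≤s z≤n)))) (ℕₚ.*-zeroʳ j)
absorption (suc n) zero    = trans (cong (1 *ℕ_) (nC1≡n (suc (suc n)))) (ℕₚ.*-comm 1 (suc (suc n)))
absorption (suc n) (suc j) = begin
  suc (suc j) *ℕ (suc (suc n) C suc (suc j))
    ≡⟨ cong (suc (suc j) *ℕ_) (nCk+nC[k+1]≡[n+1]C[k+1] (suc n) (suc j)) ⟨
  suc (suc j) *ℕ ((suc n C suc j) +ℕ (suc n C suc (suc j)))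
    ≡⟨ ℕₚ.*-distribˡ-+ (suc (suc j)) (suc n C suc j) (suc n C suc (suc j)) ⟩
  (suc n C suc j) +ℕ suc j *ℕ (suc n C suc j) +ℕ suc (suc j) *ℕ (suc n C suc (suc j))
    ≡⟨ cong₂ (λ s t → (suc n C suc j) +ℕ s +ℕ t) (absorption n j) (absorption n (suc j)) ⟩
  (suc n C suc j) +ℕ suc n *ℕ (n C j) +ℕ suc n *ℕ (n C suc j)
    ≡⟨ ℕₚ.+-assoc (suc n C suc j) _ _ ⟩
  (suc n C suc j) +ℕ (suc n *ℕ (n C j) +ℕ suc n *ℕ (n C suc j))
    ≡⟨ cong ((suc n C suc j) +ℕ_) (ℕₚ.*-distribˡ-+ (suc n) (n C j) (n C suc j)) ⟨
  (suc n C suc j) +ℕ suc n *ℕ ((n C j) +ℕ (n C suc j))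
    ≡⟨ cong (λ b → (suc n C suc j) +ℕ suc n *ℕ b) (nCk+nC[k+1]≡[n+1]C[k+1] n j) ⟩
  suc (suc n) *ℕ (suc n C suc j)  ∎

-- Reduction to lowest terms only cancels a factor of the denominator. Hence any representation with
-- denominator prime to p proves integrality, in particular the unreduced ones of sums and products.
↧ₙ[i/n]∣n : ∀ i n .{{_ : ℕ.NonZero n}} → ↧ₙ (i ℚ./ n) ∣ n
↧ₙ[i/n]∣n i n = divides ℤ.∣ gcd ∣ (sym (begin
  ℤ.∣ gcd ∣ *ℕ ↧ₙ (i ℚ./ n)                  ≡⟨ ℕₚ.*-comm ℤ.∣ gcd ∣ _ ⟩
  ↧ₙ (i ℚ./ n) *ℕ ℤ.∣ gcd ∣                  ≡⟨ ℤₚ.abs-* (ℚ.↧ (i ℚ./ n)) gcd ⟨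
  ℤ.∣ ℚ.↧ (i ℚ./ n) ℤ.* gcd ∣                ≡⟨ cong ℤ.∣_∣ (ℚ.↧-/ i n) ⟩
  n                                          ∎))
  where
  gcd : ℤ
  gcd = ℤ.gcd i (pos n)

module Integrality (p : ℕ) (p-prime : Prime p) where

  q : ℚ
  q = ℕ→ℚ p

  -- A record around `InZp`, since x cannot be inferred from a statement about its denominator
  -- alone.
  record Integral (x : ℚ) : Set where
    constructor integral
    field inZp : InZp p x
  open Integral public

  p∤1 : ¬ p ∣ 1
  p∤1 p∣1 = Prime.¬prime[1] (subst Prime (ℕ.∣1⇒≡1 p∣1) p-prime)

  p∤<p : ∀ {n} → suc n < p → ¬ p ∣ suc n
  p∤<p 1+n<p = ℕ.>⇒∤ 1+n<p

  p∤* : ∀ {m n} → ¬ p ∣ m → ¬ p ∣ n → ¬ p ∣ m *ℕ n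
  p∤* {m} {n} p∤m p∤n p∣mn = [ p∤m , p∤n ]′ (euclidsLemma m n p-prime p∣mn)

  integral-/ : ∀ i n .{{_ : ℕ.NonZero n}} → ¬ p ∣ n → Integral (i ℚ./ n)
  integral-/ i n p∤n = integral (λ p∣ → p∤n (ℕ.∣-trans p∣ (↧ₙ[i/n]∣n i n)))

  integral-ℕ : ∀ n → Integral (ℕ→ℚ n)
  integral-ℕ n = integral-/ (pos n) 1 p∤1

  integral-0 : Integral 0ℚ
  integral-0 = integral-ℕ 0

  integral-1 : Integral 1ℚ
  integral-1 = integral-ℕ 1

  integral-neg : ∀ {x} → Integral x → Integral (- x)
  integral-neg {x} (integral ix) = integral (subst (λ d → ¬ p ∣ d) (cong ℤ.∣_∣ (sym (ℚ.↧-neg x))) ix)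

  integral-+ : ∀ {x y} → Integral x → Integral y → Integral (x + y)
  integral-+ {mkℚ m d _} {mkℚ n e _} (integral ix) (integral iy) =
    integral-/ (m ℤ.* pos (suc e) ℤ.+ n ℤ.* pos (suc d)) (suc d *ℕ suc e) (p∤* ix iy)

  integral-* : ∀ {x y} → Integral x → Integral y → Integral (x * y)
  integral-* {mkℚ m d _} {mkℚ n e _} (integral ix) (integral iy) = integral-/ (m ℤ.* n) (suc d *ℕ suc e) (p∤* ix iy)

  integral-- : ∀ {x y} → Integral x → Integral y → Integral (x - y)
  integral-- ix iy = integral-+ ix (integral-neg iy)

  integral-^ : ∀ {x} n → Integral x → Integral (x ^ℚ n)
  integral-^ zero    ix = integral-1
  integral-^ (suc n) ix = integral-* ix (integral-^ n ix)

  integral-sumTo : ∀ n {f} → (∀ {j} → j ≤ n → Integral (f j)) → Integral (sumTo n f)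
  integral-sumTo zero    if = if z≤n
  integral-sumTo (suc n) if = integral-+ (integral-sumTo n (λ j≤n → if (ℕₚ.m≤n⇒m≤1+n j≤n))) (if ℕₚ.≤-refl)

  integral-sum1To : ∀ n {f} → (∀ j → Integral (f j)) → Integral (sum1To n f)
  integral-sum1To zero    if = integral-0
  integral-sum1To (suc n) if = integral-+ (integral-sum1To n if) (if (suc n))

  -- The ideal pᵐℤₚ. Congruences are treated as membership of a difference, so that proving one
  -- means writing the difference as a combination of known members.
  record Ideal (m : ℕ) (x : ℚ) : Set where
    constructor ideal
    field
      quotient          : ℚ
      quotient-integral : Integral quotient
      factorisation     : x ≡ (q ^ℚ m) * quotient

  ideal-+ : ∀ {m x y} → Ideal m x → Ideal m y → Ideal m (x + y)
  ideal-+ {m} (ideal s is x≡) (ideal t it y≡) =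
    ideal (s + t) (integral-+ is it) (trans (cong₂ _+_ x≡ y≡) (sym (ℚ.*-distribˡ-+ (q ^ℚ m) s t)))

  ideal-*ˡ : ∀ {m z x} → Integral z → Ideal m x → Ideal m (z * x)
  ideal-*ˡ {m} {z} iz (ideal t it x≡) = ideal (z * t) (integral-* iz it) (trans (cong (z *_) x≡) (swap z (q ^ℚ m) t))
    where
    swap : ∀ z a t → z * (a * t) ≡ a * (z * t)
    swap = solve-∀ ring

  ideal-neg : ∀ {m x} → Ideal m x → Ideal m (- x)
  ideal-neg {m} (ideal t it x≡) =
    ideal (- t) (integral-neg it) (trans (cong -_ x≡) (ℚ.neg-distribʳ-* (q ^ℚ m) t))

  ideal-- : ∀ {m x y} → Ideal m x → Ideal m y → Ideal m (x - y)
  ideal-- ix iy = ideal-+ ix (ideal-neg iy)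

  ideal-resp : ∀ {m x y} → x ≡ y → Ideal m y → Ideal m x
  ideal-resp x≡y (ideal t it y≡) = ideal t it (trans x≡y y≡)

  ideal-0 : ∀ {m} → Ideal m 0ℚ
  ideal-0 {m} = ideal 0ℚ integral-0 (sym (ℚ.*-zeroʳ (q ^ℚ m)))

  ideal-q : Ideal 1 q
  ideal-q = ideal 1ℚ integral-1 (sym (trans (ℚ.*-identityʳ (q * 1ℚ)) (ℚ.*-identityʳ q)))

  ideal-* : ∀ {x y} → Ideal 1 x → Ideal 1 y → Ideal 2 (x * y)
  ideal-* (ideal s is x≡) (ideal t it y≡) = ideal (s * t) (integral-* is it) (trans (cong₂ _*_ x≡ y≡) (regroup q s t))
    where
    regroup : ∀ q s t → q * 1ℚ * s * (q * 1ℚ * t) ≡ q * (q * 1ℚ) * (s * t)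
    regroup = solve-∀ ring

  ideal-weaken : ∀ {x} → Ideal 2 x → Ideal 1 x
  ideal-weaken (ideal t it x≡) = ideal (q * t) (integral-* (integral-ℕ p) it) (trans x≡ (regroup q t))
    where
    regroup : ∀ q t → q * (q * 1ℚ) * t ≡ q * 1ℚ * (q * t)
    regroup = solve-∀ ring

  ideal⇒integral : ∀ {m x} → Ideal m x → Integral x
  ideal⇒integral {m} (ideal t it x≡) = subst Integral (sym x≡) (integral-* (integral-^ m (integral-ℕ p)) it)

  ideal-sumTo : ∀ {m} n {f} → (∀ {j} → j ≤ n → Ideal m (f j)) → Ideal m (sumTo n f)
  ideal-sumTo zero    if = if z≤n
  ideal-sumTo (suc n) if = ideal-+ (ideal-sumTo n (λ j≤n → if (ℕₚ.m≤n⇒m≤1+n j≤n))) (if ℕₚ.≤-refl)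

  record Unit (u : ℚ) : Set where
    constructor unit
    field
      inverse          : ℚ
      inverse-integral : Integral inverse
      *-inverse        : u * inverse ≡ 1ℚ

  unit-ℕ : ∀ n → suc n < p → Unit (ℕ→ℚ (suc n))
  unit-ℕ n 1+n<p =
    unit (pos 1 ℚ./ suc n) (integral-/ (pos 1) (suc n) (p∤<p 1+n<p)) (*-1/ (suc n))

  unit-* : ∀ {u u′} → Unit u → Unit u′ → Unit (u * u′)
  unit-* {u} {u′} (unit v iv uv≡1) (unit v′ iv′ uv′≡1) =
    unit (v * v′) (integral-* iv iv′) (trans (interchange u u′ v v′) (cong₂ _*_ uv≡1 uv′≡1))
    where
    interchange : ∀ a b c d → a * b * (c * d) ≡ a * c * (b * d)
    interchange = solve-∀ ring

  ideal-cancel : ∀ {m u x} → Unit u → Ideal m (u * x) → Ideal m x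
  ideal-cancel {u = u} {x} (unit v iv uv≡1) iux = ideal-resp
    (trans (sym (ℚ.*-identityˡ x)) (trans (cong (_* x) (sym uv≡1)) (rotate u v x))) (ideal-*ˡ iv iux)
    where
    rotate : ∀ u v x → u * v * x ≡ v * (u * x)
    rotate = solve-∀ ring

  -- Cancellation in two rounds. Modulo p the summand e x disappears, so p divides x; then e x lies
  -- in p²ℤₚ and u can be cancelled modulo p². No inverse of u + e is ever formed.
  ideal-cancel-perturbed : ∀ {u e x} → Unit u → Ideal 1 e → Integral x → Ideal 2 ((u + e) * x) → Ideal 2 x
  ideal-cancel-perturbed {u} {e} {x} uu ie ix i2 =
    ideal-cancel uu (ideal-resp (split u e x) (ideal-- i2 (ideal-* ie ix₁)))
    where
    split : ∀ u e x → u * x ≡ (u + e) * x - e * x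
    split = solve-∀ ring
    split′ : ∀ u e x → u * x ≡ (u + e) * x - x * e
    split′ = solve-∀ ring
    ix₁ : Ideal 1 x
    ix₁ = ideal-cancel uu (ideal-resp (split′ u e x) (ideal-- (ideal-weaken i2) (ideal-*ˡ ix ie)))

  integral-umbral : ∀ {y} n {c} → Integral y → (∀ k → Integral (c k)) → Integral (umbral y n c)
  integral-umbral zero    iy ic = ic 0
  integral-umbral (suc n) iy ic = integral-+ (integral-* iy (integral-umbral n iy ic)) (integral-umbral n iy (ic ∘ suc))

  umbral-congruent : ∀ {x y} n {c} → Integral x → Integral y → (∀ k → Integral (c k)) →
                     Ideal 1 (x - y) → Ideal 1 (umbral x n c - umbral y n c)
  umbral-congruent zero {c} ix iy ic i = ideal-resp (ℚ.+-inverseʳ (c 0)) ideal-0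
  umbral-congruent {x} {y} (suc n) {c} ix iy ic i = ideal-resp
    (split x y (umbral x n c) (umbral y n c) (umbral x n (c ∘ suc)) (umbral y n (c ∘ suc)))
    (ideal-+ (ideal-+ (ideal-*ˡ ix (umbral-congruent n ix iy ic i)) (ideal-*ˡ (integral-umbral n iy ic) i))
             (umbral-congruent n ix iy (ic ∘ suc) i))
    where
    split : ∀ x y s t u v → x * s + u - (y * t + v) ≡ x * (s - t) + t * (x - y) + (u - v)
    split = solve-∀ ring

  integral-eulerF : ∀ f n → Integral (eulerF f n)
  integral-eulerF zero    n       = integral-0
  integral-eulerF (suc f) zero    = integral-1
  integral-eulerF (suc f) (suc n) = integral-neg (integral-sum1To (suc n / 2)
    (λ k → integral-* (integral-ℕ (suc n C (2 *ℕ k))) (integral-eulerF f (suc n ∸ 2 *ℕ k))))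

  integral-euler : ∀ n → Integral (euler n)
  integral-euler n = integral-eulerF (suc n) n

  -- The difference is the sum of the inner binomial terms C(p, j) x^(p-j) with 0 < j < p, each
  -- divisible by p.
  fermat-step : ∀ {x} → Integral x → Ideal 1 ((x + 1ℚ) ^ℚ p - x ^ℚ p - 1ℚ)
  fermat-step {x} ix = go p p-prime refl
    where
    -- The exponent gets its own variable, which can be split as n + 2, while the ideal keeps the
    -- fixed prime p.
    go : ∀ n → Prime n → n ≡ p → Ideal 1 ((x + 1ℚ) ^ℚ n - x ^ℚ n - 1ℚ)
    go 0 0-prime _ = contradiction 0-prime Prime.¬prime[0]
    go 1 1-prime _ = contradiction 1-prime Prime.¬prime[1]
    go (suc (suc n)) _ 2+n≡p = ideal-resp expand (ideal-sumTo n middle)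
      where
      -- The trailing factor 1 is the constant umbra, for which the umbral expansion is the binomial
      -- theorem.
      term : ℕ → ℚ
      term j = ℕ→ℚ (suc (suc n) C j) * (x ^ℚ (suc (suc n) ∸ j)) * 1ℚ

      -- Here (j+1) C(p, j+1) = p C(p-1, j), and j + 1 < p is a unit that can be cancelled.
      middle : ∀ {j} → j ≤ n → Ideal 1 (term (suc j))
      middle {j} j≤n = ideal-resp (ℚ.*-identityʳ _) (ideal-resp (ℚ.*-comm (ℕ→ℚ (suc (suc n) C suc j)) _)
        (ideal-*ˡ (integral-^ (suc n ∸ j) ix) (ideal-cancel (unit-ℕ j 1+j<p) (ideal-resp eq
          (ideal-*ˡ (integral-ℕ (suc n C j)) ideal-q)))))
        where
        1+j<p : suc j < p
        1+j<p = subst (suc j <_) 2+n≡p (s≤s (s≤s j≤n))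
        eq : ℕ→ℚ (suc j) * ℕ→ℚ (suc (suc n) C suc j) ≡ ℕ→ℚ (suc n C j) * q
        eq = begin
          ℕ→ℚ (suc j) * ℕ→ℚ (suc (suc n) C suc j)     ≡⟨ ℕ→ℚ-* (suc j) (suc (suc n) C suc j) ⟨
          ℕ→ℚ (suc j *ℕ (suc (suc n) C suc j))        ≡⟨ cong ℕ→ℚ (absorption (suc n) j) ⟩
          ℕ→ℚ (suc (suc n) *ℕ (suc n C j))            ≡⟨ ℕ→ℚ-* (suc (suc n)) (suc n C j) ⟩
          ℕ→ℚ (suc (suc n)) * ℕ→ℚ (suc n C j)         ≡⟨ ℚ.*-comm (ℕ→ℚ (suc (suc n))) (ℕ→ℚ (suc n C j)) ⟩
          ℕ→ℚ (suc n C j) * ℕ→ℚ (suc (suc n))         ≡⟨ cong (λ k → ℕ→ℚ (suc n C j) * ℕ→ℚ k) 2+n≡p ⟩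
          ℕ→ℚ (suc n C j) * q                         ∎

      first : term 0 ≡ x ^ℚ (suc (suc n))
      first = trans (ℚ.*-identityʳ _) (ℚ.*-identityˡ (x ^ℚ (suc (suc n))))

      last : term (suc (suc n)) ≡ 1ℚ
      last = cong₂ (λ b e → ℕ→ℚ b * (x ^ℚ e) * 1ℚ) (nCn≡1 (suc (suc n))) (ℕₚ.n∸n≡0 n)

      isolate : ∀ f s l → f + (s + l) - f - l ≡ s
      isolate = solve-∀ ring

      expand : (x + 1ℚ) ^ℚ suc (suc n) - x ^ℚ suc (suc n) - 1ℚ ≡ sumTo n (term ∘ suc)
      expand = begin
        (x + 1ℚ) ^ℚ suc (suc n) - x ^ℚ suc (suc n) - 1ℚ
          ≡⟨ cong (λ s → s - x ^ℚ suc (suc n) - 1ℚ) (umbral-1 x (suc (suc n))) ⟨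
        umbral x (suc (suc n)) (const 1ℚ) - x ^ℚ suc (suc n) - 1ℚ
          ≡⟨ cong (λ s → s - x ^ℚ suc (suc n) - 1ℚ) (trans (umbral≡sum x (suc (suc n)) (const 1ℚ)) (sumTo-head (suc n) term)) ⟩
        term 0 + (sumTo n (term ∘ suc) + term (suc (suc n))) - x ^ℚ suc (suc n) - 1ℚ
          ≡⟨ cong₂ (λ f l → term 0 + (sumTo n (term ∘ suc) + term (suc (suc n))) - f - l) first last ⟨
        term 0 + (sumTo n (term ∘ suc) + term (suc (suc n))) - term 0 - term (suc (suc n))
          ≡⟨ isolate (term 0) (sumTo n (term ∘ suc)) (term (suc (suc n))) ⟩
        sumTo n (term ∘ suc)  ∎

  fermat : ∀ n → Ideal 1 (ℕ→ℚ n ^ℚ p - ℕ→ℚ n)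
  fermat zero = ideal-resp (0^ p p-prime) ideal-0
    where
    0^ : ∀ n → Prime n → 0ℚ ^ℚ n - 0ℚ ≡ 0ℚ
    0^ zero    0-prime = contradiction 0-prime Prime.¬prime[0]
    0^ (suc n) _       = trans (ℚ.+-identityʳ _) (ℚ.*-zeroˡ (0ℚ ^ℚ n))
  fermat (suc n) = ideal-resp
    (trans (cong (λ x → x ^ℚ p - x) (trans (ℕ→ℚ-suc n) (ℚ.+-comm 1ℚ (ℕ→ℚ n))))
           (split ((ℕ→ℚ n + 1ℚ) ^ℚ p) (ℕ→ℚ n ^ℚ p) (ℕ→ℚ n)))
    (ideal-+ (fermat-step (integral-ℕ n)) (fermat n))
    where
    split : ∀ a b n → a - (n + 1ℚ) ≡ a - b - 1ℚ + (b - n)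
    split = solve-∀ ring

-- The sum Σ C(a,k) C(-1-a,k) / (2k-1)

recip : ℕ → ℚ
recip k = pos 1 ℚ./ suc k

*-recip : ∀ k → ℕ→ℚ (suc k) * recip k ≡ 1ℚ
*-recip k = *-1/ (suc k)

binomPair : ℚ → ℕ → ℚ
binomPair a k = binom a k * binom (- 1ℚ - a) k

pairSum : ℕ → ℚ → ℚ
pairSum n a = sumTo n (λ k → binom a k * binom (- 1ℚ - a) k * inv2km1 k)

-- The truncation after n factors of Euler's product for sin(πa)/(πa).
sineProduct : ℕ → ℚ → ℚ
sineProduct zero    a = 1ℚ
sineProduct (suc n) a = sineProduct n a * (1ℚ - a * a * (recip n * recip n))

binom-suc : ∀ x k → binom x (suc k) ≡ binom x k * (x - ℕ→ℚ k) * recip k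
binom-suc x k = trans
  (cong (fallFact x (suc k) *_) (1/-* (suc k) (k !) {{_}} {{k ℕₚ.!≢0}} {{suc k ℕₚ.!≢0}}))
  (regroup (fallFact x k) (x - ℕ→ℚ k) (recip k) ((pos 1 ℚ./ (k !)) {{k ℕₚ.!≢0}}))
  where
  regroup : ∀ f y r s → f * y * (r * s) ≡ f * s * y * r
  regroup = solve-∀ ring

binomPair-suc : ∀ a k → binomPair a (suc k)
                        ≡ - (binomPair a k * (a - ℕ→ℚ k) * (a + (1ℚ + ℕ→ℚ k)) * (recip k * recip k))
binomPair-suc a k = trans
  (cong₂ _*_ (binom-suc a k) (binom-suc (- 1ℚ - a) k))
  (regroup a (ℕ→ℚ k) (binom a k) (binom (- 1ℚ - a) k) (recip k))
  where
  regroup : ∀ a κ b c i → b * (a - κ) * i * (c * (- 1ℚ - a - κ) * i) ≡ - (b * c * (a - κ) * (a + (1ℚ + κ)) * (i * i))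
  regroup = solve-∀ ring

-- Up to the sign (-1)^k and the denominator k!², the pair is the product of the a + j for -k < j ≤
-- k. The factor a - k makes this range symmetric, and a - j joins a + j to give the factors 1 -
-- a²/j².
binomPair-sineProduct : ∀ a k → binomPair a k * (a - ℕ→ℚ k) ≡ a * sineProduct k a
binomPair-sineProduct a zero    = start a
  where
  start : ∀ a → 1ℚ * (a - 0ℚ) ≡ a * 1ℚ
  start = solve-∀ ring
binomPair-sineProduct a (suc k) = begin
  binomPair a (suc k) * (a - ℕ→ℚ (suc k))
    ≡⟨ cong₂ (λ s t → s * (a - t)) (binomPair-suc a k) (ℕ→ℚ-suc k) ⟩
  - (binomPair a k * (a - κ) * (a + (1ℚ + κ)) * (i * i)) * (a - (1ℚ + κ))
    ≡⟨ cong (λ s → - (s * (a + (1ℚ + κ)) * (i * i)) * (a - (1ℚ + κ))) (binomPair-sineProduct a k) ⟩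
  - (a * D * (a + (1ℚ + κ)) * (i * i)) * (a - (1ℚ + κ))
    ≡⟨ regroup a D (1ℚ + κ) i ⟩
  a * (D * (((1ℚ + κ) * i) * ((1ℚ + κ) * i) - a * a * (i * i)))
    ≡⟨ cong (λ s → a * (D * (s * s - a * a * (i * i)))) (trans (cong (_* i) (sym (ℕ→ℚ-suc k))) (*-recip k)) ⟩
  a * (D * (1ℚ - a * a * (i * i)))  ∎
  where
  κ i D : ℚ
  κ = ℕ→ℚ k
  i = recip k
  D = sineProduct k a
  regroup : ∀ a D κ i → - (a * D * (a + κ) * (i * i)) * (a - κ) ≡ a * (D * ((κ * i) * (κ * i) - a * a * (i * i)))
  regroup = solve-∀ ring

binomPair-closed : ∀ a k → binomPair a (suc k) ≡ - (a * sineProduct k a * (a + ℕ→ℚ (suc k)) * (recip k * recip k))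
binomPair-closed a k = trans (binomPair-suc a k)
  (cong₂ (λ s t → - (s * (a + t) * (recip k * recip k))) (binomPair-sineProduct a k) (sym (ℕ→ℚ-suc k)))

binomPair-reflect : ∀ a k → binomPair (- 1ℚ - a) k ≡ binomPair a k
binomPair-reflect a k = trans (cong (λ z → binom (- 1ℚ - a) k * binom z k) (involutive a)) (ℚ.*-comm (binom (- 1ℚ - a) k) (binom a k))
  where
  involutive : ∀ a → - 1ℚ - (- 1ℚ - a) ≡ a
  involutive = solve-∀ ring

pairSum-reflect : ∀ n a → pairSum n (- 1ℚ - a) ≡ pairSum n a
pairSum-reflect n a = sumTo-cong n (λ {k} _ → cong (_* inv2km1 k) (binomPair-reflect a k))

sineProduct-even : ∀ n a → sineProduct n (- a) ≡ sineProduct n a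
sineProduct-even zero    a = refl
sineProduct-even (suc n) a = cong₂ (λ s t → s * (1ℚ - t * (recip n * recip n))) (sineProduct-even n a) (square a)
  where
  square : ∀ a → - a * - a ≡ a * a
  square = solve-∀ ring

-- Since a - 1 = -1 - (-a), the reflection turns a - 1 into -a. As the product is even in a, the
-- closed forms at a and a - 1 differ only in the sign of k + 1.
binomPair-closed-pred : ∀ a k → binomPair (a - 1ℚ) (suc k) ≡ - (a * sineProduct k a * (a - ℕ→ℚ (suc k)) * (recip k * recip k))
binomPair-closed-pred a k = begin
  binomPair (a - 1ℚ) (suc k)
    ≡⟨ cong (λ z → binomPair z (suc k)) (flip a) ⟩
  binomPair (- 1ℚ - (- a)) (suc k)
    ≡⟨ binomPair-reflect (- a) (suc k) ⟩
  binomPair (- a) (suc k)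
    ≡⟨ binomPair-closed (- a) k ⟩
  - (- a * sineProduct k (- a) * (- a + ℕ→ℚ (suc k)) * (recip k * recip k))
    ≡⟨ cong (λ D → - (- a * D * (- a + ℕ→ℚ (suc k)) * (recip k * recip k))) (sineProduct-even k a) ⟩
  - (- a * sineProduct k a * (- a + ℕ→ℚ (suc k)) * (recip k * recip k))
    ≡⟨ signs a (sineProduct k a) (ℕ→ℚ (suc k)) (recip k) ⟩
  - (a * sineProduct k a * (a - ℕ→ℚ (suc k)) * (recip k * recip k))  ∎
  where
  flip : ∀ a → a - 1ℚ ≡ - 1ℚ - (- a)
  flip = solve-∀ ring
  signs : ∀ a D κ i → - (- a * D * (- a + κ) * (i * i)) ≡ - (a * D * (a - κ) * (i * i))
  signs = solve-∀ ring

ℕ→ℚ-odd : ∀ k → ℕ→ℚ (suc (2 *ℕ k)) ≡ 2ℚ * ℕ→ℚ k + 1ℚ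
ℕ→ℚ-odd k = trans (ℕ→ℚ-suc (2 *ℕ k)) (trans (ℚ.+-comm 1ℚ (ℕ→ℚ (2 *ℕ k))) (cong (_+ 1ℚ) (ℕ→ℚ-* 2 k)))

2κ-1≡odd : ∀ k → 2ℚ * ℕ→ℚ (suc k) - 1ℚ ≡ ℕ→ℚ (suc (2 *ℕ k))
2κ-1≡odd k = trans (cong (λ z → 2ℚ * z - 1ℚ) (ℕ→ℚ-suc k)) (trans (expand (ℕ→ℚ k)) (sym (ℕ→ℚ-odd k)))
  where
  expand : ∀ κ → 2ℚ * (1ℚ + κ) - 1ℚ ≡ 2ℚ * κ + 1ℚ
  expand = solve-∀ ring

*-inv2km1 : ∀ k → (2ℚ * ℕ→ℚ (suc k) - 1ℚ) * inv2km1 (suc k) ≡ 1ℚ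
*-inv2km1 k = trans (cong (_* inv2km1 (suc k)) (2κ-1≡odd k)) (*-1/ (suc (2 *ℕ k)))

-- The coefficients are chosen to remove the denominators: with κ the new index, (2a - 1)(a + κ) -
-- (2a + 1)(a - κ) = 2a(2κ - 1). What remains of the new term is -2a²/κ² times the previous product,
-- exactly the increment of twice the product.
pairSum-recurrence : ∀ n a → (2ℚ * a - 1ℚ) * pairSum n a - (2ℚ * a + 1ℚ) * pairSum n (a - 1ℚ) ≡ 2ℚ * sineProduct n a
pairSum-recurrence zero    a = start a
  where
  start : ∀ a → (2ℚ * a - 1ℚ) * - 1ℚ - (2ℚ * a + 1ℚ) * - 1ℚ ≡ 2ℚ * 1ℚ
  start = solve-∀ ring
pairSum-recurrence (suc n) a = begin
  (2ℚ * a - 1ℚ) * (S + binomPair a (suc n) * w) - (2ℚ * a + 1ℚ) * (S′ + binomPair (a - 1ℚ) (suc n) * w)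
    ≡⟨ cong₂ (λ u u′ → (2ℚ * a - 1ℚ) * (S + u * w) - (2ℚ * a + 1ℚ) * (S′ + u′ * w)) (binomPair-closed a n) (binomPair-closed-pred a n) ⟩
  (2ℚ * a - 1ℚ) * (S + - (a * D * (a + κ) * (i * i)) * w) - (2ℚ * a + 1ℚ) * (S′ + - (a * D * (a - κ) * (i * i)) * w)
    ≡⟨ regroup a S S′ D κ i w ⟩
  ((2ℚ * a - 1ℚ) * S - (2ℚ * a + 1ℚ) * S′) - 2ℚ * (D * (a * a * (i * i))) * ((2ℚ * κ - 1ℚ) * w)
    ≡⟨ cong₂ (λ s t → s - 2ℚ * (D * (a * a * (i * i))) * t) (pairSum-recurrence n a) (*-inv2km1 n) ⟩
  2ℚ * D - 2ℚ * (D * (a * a * (i * i))) * 1ℚ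
    ≡⟨ collect D (a * a * (i * i)) ⟩
  2ℚ * (D * (1ℚ - a * a * (i * i)))  ∎
  where
  S S′ D κ i w : ℚ
  S  = pairSum n a
  S′ = pairSum n (a - 1ℚ)
  D  = sineProduct n a
  κ  = ℕ→ℚ (suc n)
  i  = recip n
  w  = inv2km1 (suc n)
  regroup : ∀ a S S′ D κ i w →
    (2ℚ * a - 1ℚ) * (S + - (a * D * (a + κ) * (i * i)) * w) - (2ℚ * a + 1ℚ) * (S′ + - (a * D * (a - κ) * (i * i)) * w)
    ≡ ((2ℚ * a - 1ℚ) * S - (2ℚ * a + 1ℚ) * S′) - 2ℚ * (D * (a * a * (i * i))) * ((2ℚ * κ - 1ℚ) * w)
  regroup = solve-∀ ring
  collect : ∀ D z → 2ℚ * D - 2ℚ * (D * z) * 1ℚ ≡ 2ℚ * (D * (1ℚ - z))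
  collect = solve-∀ ring

-- Up to a constant, a times the product is the product of all a + j with -n ≤ j ≤ n. Replacing a by
-- a - 1 exchanges the factor a + n for a - n - 1.
sineProduct-recurrence : ∀ n a → (ℕ→ℚ n + 1ℚ - a) * (a * sineProduct n a) ≡ - ((ℕ→ℚ n + a) * ((a - 1ℚ) * sineProduct n (a - 1ℚ)))
sineProduct-recurrence zero    a = start a
  where
  start : ∀ a → (0ℚ + 1ℚ - a) * (a * 1ℚ) ≡ - ((0ℚ + a) * ((a - 1ℚ) * 1ℚ))
  start = solve-∀ ring
sineProduct-recurrence (suc n) a = begin
  (ℕ→ℚ (suc n) + 1ℚ - a) * (a * (D * (1ℚ - a * a * (i * i))))
    -- The constant 1 becomes ((1 + κ) i)², so that the last bracket factors as a difference of
    -- squares.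
    ≡⟨ cong₂ (λ z s → (z + 1ℚ - a) * (a * (D * (s * s - a * a * (i * i))))) (ℕ→ℚ-suc n) (sym κi≡1) ⟩
  (1ℚ + κ + 1ℚ - a) * (a * (D * (((1ℚ + κ) * i) * ((1ℚ + κ) * i) - a * a * (i * i))))
    ≡⟨ factor a D κ i ⟩
  (1ℚ + κ + 1ℚ - a) * (1ℚ + κ + a) * (i * i) * ((κ + 1ℚ - a) * (a * D))
    ≡⟨ cong ((1ℚ + κ + 1ℚ - a) * (1ℚ + κ + a) * (i * i) *_) (sineProduct-recurrence n a) ⟩
  (1ℚ + κ + 1ℚ - a) * (1ℚ + κ + a) * (i * i) * - ((κ + a) * ((a - 1ℚ) * D′))
    ≡⟨ unfactor a D′ κ i ⟩
  - ((1ℚ + κ + a) * ((a - 1ℚ) * (D′ * (((1ℚ + κ) * i) * ((1ℚ + κ) * i) - (a - 1ℚ) * (a - 1ℚ) * (i * i)))))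
    ≡⟨ cong₂ (λ z s → - ((z + a) * ((a - 1ℚ) * (D′ * (s * s - (a - 1ℚ) * (a - 1ℚ) * (i * i)))))) (sym (ℕ→ℚ-suc n)) κi≡1 ⟩
  - ((ℕ→ℚ (suc n) + a) * ((a - 1ℚ) * (D′ * (1ℚ - (a - 1ℚ) * (a - 1ℚ) * (i * i)))))  ∎
  where
  κ i D D′ : ℚ
  κ  = ℕ→ℚ n
  i  = recip n
  D  = sineProduct n a
  D′ = sineProduct n (a - 1ℚ)
  κi≡1 : (1ℚ + κ) * i ≡ 1ℚ
  κi≡1 = trans (cong (_* i) (sym (ℕ→ℚ-suc n))) (*-recip n)
  factor : ∀ a D κ i → (1ℚ + κ + 1ℚ - a) * (a * (D * (((1ℚ + κ) * i) * ((1ℚ + κ) * i) - a * a * (i * i))))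
                       ≡ (1ℚ + κ + 1ℚ - a) * (1ℚ + κ + a) * (i * i) * ((κ + 1ℚ - a) * (a * D))
  factor = solve-∀ ring
  unfactor : ∀ a D κ i → (1ℚ + κ + 1ℚ - a) * (1ℚ + κ + a) * (i * i) * - ((κ + a) * ((a - 1ℚ) * D))
                         ≡ - ((1ℚ + κ + a) * ((a - 1ℚ) * (D * (((1ℚ + κ) * i) * ((1ℚ + κ) * i) - (a - 1ℚ) * (a - 1ℚ) * (i * i)))))
  unfactor = solve-∀ ring

-- The congruence for p = 2k + 3

module OddPrime (k : ℕ) (p-prime : Prime (suc (suc (suc (2 *ℕ k))))) where

  open Integrality (suc (suc (suc (2 *ℕ k)))) p-prime

  -- With p in this constructor form, p - 2 reduces to n, which is visibly odd and positive, and m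
  -- is (p - 1)/2.
  p m n : ℕ
  p = suc (suc (suc (2 *ℕ k)))
  m = suc k
  n = suc (2 *ℕ k)

  q≡2m+1 : q ≡ 2ℚ * ℕ→ℚ m + 1ℚ
  q≡2m+1 = trans (cong (ℕ→ℚ ∘ suc) (sym (ℕₚ.*-suc 2 k))) (ℕ→ℚ-odd m)

  1+2j<p : ∀ {j} → j < m → suc (2 *ℕ j) < p
  1+2j<p (s≤s j≤k) = s≤s (s≤s (ℕₚ.m≤n⇒m≤1+n (ℕₚ.*-monoʳ-≤ 2 j≤k)))

  2+2j<p : ∀ {j} → j < m → suc (suc (2 *ℕ j)) < p
  2+2j<p (s≤s j≤k) = s≤s (s≤s (s≤s (ℕₚ.*-monoʳ-≤ 2 j≤k)))

  1+j<p : ∀ {j} → j < m → suc j < p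
  1+j<p {j} j<m = ℕₚ.≤-<-trans (s≤s (ℕₚ.m≤m+n j (j +ℕ 0))) (1+2j<p j<m)

  integral-2 : Integral 2ℚ
  integral-2 = integral-ℕ 2

  integral-recip : ∀ {j} → j < m → Integral (recip j)
  integral-recip {j} j<m = integral-/ (pos 1) (suc j) (p∤<p (1+j<p j<m))

  -- The Euler polynomial of degree p - 2 modulo p

  pow : ℚ → ℚ
  pow x = x ^ℚ n

  pow-neg : ∀ x → pow (- x) ≡ - pow x
  pow-neg x = begin
    pow (- x)                                 ≡⟨ cong pow (neg x) ⟩
    pow (- 1ℚ * x)                            ≡⟨ ^ℚ-*-distrib (- 1ℚ) x n ⟩
    - 1ℚ * ((- 1ℚ) ^ℚ (2 *ℕ k)) * pow x       ≡⟨ cong (λ s → - 1ℚ * s * pow x) (-1^ℚ-even k) ⟩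
    - 1ℚ * pow x                              ≡⟨ neg (pow x) ⟨
    - pow x                                   ∎
    where
    neg : ∀ x → - x ≡ - 1ℚ * x
    neg = solve-∀ ring

  -- Fermat's congruence x^p ≡ x with one factor x cancelled: the power p - 2 is an inverse modulo
  -- p.
  pow-inverse : ∀ j → suc j < p → Ideal 1 (ℕ→ℚ (suc j) * pow (ℕ→ℚ (suc j)) - 1ℚ)
  pow-inverse j 1+j<p′ = ideal-cancel (unit-ℕ j 1+j<p′)
    (ideal-resp (distrib (ℕ→ℚ (suc j)) (ℕ→ℚ (suc j) * pow (ℕ→ℚ (suc j)))) (fermat (suc j)))
    where
    distrib : ∀ x y → x * (y - 1ℚ) ≡ x * y - x
    distrib = solve-∀ ring

  E : ℚ → ℚ
  E = eulerPoly n

  -- The power of 2 is the only denominator in the Euler polynomial, and 2 < p.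
  integral-½^n : Integral (½ ^ℚ n)
  integral-½^n = integral-^ n (integral-/ (pos 1) 2 (p∤<p (s≤s (s≤s (s≤s z≤n)))))

  integral-2x-1 : ∀ {x} → Integral x → Integral (2ℚ * x - 1ℚ)
  integral-2x-1 ix = integral-- (integral-* integral-2 ix) integral-1

  integral-E : ∀ {x} → Integral x → Integral (E x)
  integral-E {x} ix = subst Integral (sym (eulerPoly≡umbral n x))
    (integral-* integral-½^n (integral-umbral n (integral-2x-1 ix) integral-euler))

  E-congruent : ∀ {x y} → Integral x → Integral y → Ideal 1 (x - y) → Ideal 1 (E x - E y)
  E-congruent {x} {y} ix iy x≡y = ideal-resp
    (trans (cong₂ _-_ (eulerPoly≡umbral n x) (eulerPoly≡umbral n y))
           (factor (½ ^ℚ n) (umbral (2ℚ * x - 1ℚ) n euler) (umbral (2ℚ * y - 1ℚ) n euler)))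
    (ideal-*ˡ integral-½^n (umbral-congruent n (integral-2x-1 ix) (integral-2x-1 iy) integral-euler
      (ideal-resp (double x y) (ideal-*ˡ integral-2 x≡y))))
    where
    factor : ∀ h s t → h * s - h * t ≡ h * (s - t)
    factor = solve-∀ ring
    double : ∀ x y → 2ℚ * x - 1ℚ - (2ℚ * y - 1ℚ) ≡ 2ℚ * (x - y)
    double = solve-∀ ring

  E-0+1 : E 0ℚ + E 1ℚ ≡ 0ℚ
  E-0+1 = trans (eulerPoly-+-shift n 0ℚ) (cong (2ℚ *_) (ℚ.*-zeroˡ (0ℚ ^ℚ (2 *ℕ k))))

  -- The argument is -2a at a = r, so a unit step of a corresponds to two applications of the shift
  -- rule.
  ε : ℕ → ℚ
  ε r = E (- (2ℚ * ℕ→ℚ r))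

  integral-ε : ∀ r → Integral (ε r)
  integral-ε r = integral-E (integral-neg (integral-* integral-2 (integral-ℕ r)))

  -- The shift rules at -c and 1 - c, for c = 2(r+1), are subtracted to eliminate the value at 1 -
  -- c. The exponent is odd, which moves the signs out of the powers.
  ε-step : ∀ r → ε (suc r) - ε r ≡ 2ℚ * (pow (2ℚ * ℕ→ℚ (suc r) - 1ℚ) - pow (2ℚ * ℕ→ℚ (suc r)))
  ε-step r = begin
    ε (suc r) - ε r
      ≡⟨ insert (ε (suc r)) (E (1ℚ + - c)) (ε r) ⟩
    (ε (suc r) + E (1ℚ + - c)) - (E (1ℚ + - c) + ε r)
      ≡⟨ cong (λ z → (ε (suc r) + E (1ℚ + - c)) - (E (1ℚ + - c) + E z)) argument ⟩
    (E (- c) + E (1ℚ + - c)) - (E (1ℚ + - c) + E (1ℚ + (1ℚ + - c)))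
      ≡⟨ cong₂ _-_ (eulerPoly-+-shift n (- c)) (eulerPoly-+-shift n (1ℚ + - c)) ⟩
    2ℚ * pow (- c) - 2ℚ * pow (1ℚ + - c)
      ≡⟨ cong₂ (λ s t → 2ℚ * s - 2ℚ * t) (pow-neg c) (trans (cong pow (flip c)) (pow-neg (c - 1ℚ))) ⟩
    2ℚ * - pow c - 2ℚ * - pow (c - 1ℚ)
      ≡⟨ collect (pow c) (pow (c - 1ℚ)) ⟩
    2ℚ * (pow (c - 1ℚ) - pow c)  ∎
    where
    c : ℚ
    c = 2ℚ * ℕ→ℚ (suc r)
    insert : ∀ x y z → x - z ≡ (x + y) - (y + z)
    insert = solve-∀ ring
    shift : ∀ ρ → - (2ℚ * ρ) ≡ 1ℚ + (1ℚ + - (2ℚ * (1ℚ + ρ)))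
    shift = solve-∀ ring
    argument : - (2ℚ * ℕ→ℚ r) ≡ 1ℚ + (1ℚ + - c)
    argument = trans (shift (ℕ→ℚ r)) (cong (λ z → 1ℚ + (1ℚ + - (2ℚ * z))) (sym (ℕ→ℚ-suc r)))
    flip : ∀ c → 1ℚ + - c ≡ - (c - 1ℚ)
    flip = solve-∀ ring
    collect : ∀ x y → 2ℚ * - x - 2ℚ * - y ≡ 2ℚ * (y - x)
    collect = solve-∀ ring

  2κ≡even : ∀ r → ℕ→ℚ (suc (suc (2 *ℕ r))) ≡ 2ℚ * ℕ→ℚ (suc r)
  2κ≡even r = trans (cong ℕ→ℚ (sym (ℕₚ.*-suc 2 r))) (ℕ→ℚ-* 2 (suc r))

  -- Both 2κ - 1 and 2κ stay below p, so their powers are inverses modulo p, and 2(1/(2κ - 1) -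
  -- 1/(2κ)) = 1/(κ(2κ - 1)).
  ε-step-congruence : ∀ {r} → r < m →
    Ideal 1 (ℕ→ℚ (suc r) * (2ℚ * ℕ→ℚ (suc r) - 1ℚ) * (ε (suc r) - ε r) - 1ℚ)
  ε-step-congruence {r} r<m = ideal-resp
    (trans (cong (λ g → κ * (2ℚ * κ - 1ℚ) * g - 1ℚ) (ε-step r)) (split κ (pow (2ℚ * κ - 1ℚ)) (pow (2ℚ * κ))))
    (ideal-- (ideal-*ˡ (integral-* integral-2 (integral-ℕ (suc r)))
                       (subst (λ o → Ideal 1 (o * pow o - 1ℚ)) (sym (2κ-1≡odd r)) (pow-inverse (2 *ℕ r) (1+2j<p r<m))))
             (ideal-*ˡ (integral-2x-1 (integral-ℕ (suc r)))
                       (subst (λ c → Ideal 1 (c * pow c - 1ℚ)) (2κ≡even r) (pow-inverse (suc (2 *ℕ r)) (2+2j<p r<m)))))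
    where
    κ : ℚ
    κ = ℕ→ℚ (suc r)
    split : ∀ κ s t → κ * (2ℚ * κ - 1ℚ) * (2ℚ * (s - t)) - 1ℚ
                      ≡ 2ℚ * κ * ((2ℚ * κ - 1ℚ) * s - 1ℚ) - (2ℚ * κ - 1ℚ) * (2ℚ * κ * t - 1ℚ)
    split = solve-∀ ring

  ε-last : Ideal 1 (ε m + ε 0)
  ε-last = ideal-resp
    (trans (insert (ε m) (ε 0) (E 1ℚ)) (trans (cong ((ε m - E 1ℚ) +_) E-0+1) (ℚ.+-identityʳ (ε m - E 1ℚ))))
    (E-congruent (integral-neg (integral-* integral-2 (integral-ℕ m))) integral-1
      (ideal-resp (trans (difference (ℕ→ℚ m)) (cong -_ (sym q≡2m+1))) (ideal-neg ideal-q)))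
    where
    insert : ∀ x y z → x + y ≡ (x - z) + (y + z)
    insert = solve-∀ ring
    difference : ∀ μ → - (2ℚ * μ) - 1ℚ ≡ - (2ℚ * μ + 1ℚ)
    difference = solve-∀ ring

  -- The reflection formula E(1 - x) = -E(x) in odd degree, at x = -2r. Induction suffices: two
  -- upward shifts from 2r + 1 and two downward shifts from -2r change the values by opposite
  -- amounts.
  ε-reflect : ∀ r → E (2ℚ * ℕ→ℚ r + 1ℚ) + ε r ≡ 0ℚ
  ε-reflect zero    = trans (ℚ.+-comm (E 1ℚ) (E 0ℚ)) E-0+1
  ε-reflect (suc r) = begin
    E (2ℚ * ℕ→ℚ (suc r) + 1ℚ) + ε (suc r)
      ≡⟨ insert (E (2ℚ * ℕ→ℚ (suc r) + 1ℚ)) (ε (suc r)) (ε r) (E c) (E (1ℚ + c)) ⟩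
    (E (1ℚ + c) + E (2ℚ * ℕ→ℚ (suc r) + 1ℚ)) - (E c + E (1ℚ + c)) + (ε (suc r) - ε r) + (E c + ε r)
      ≡⟨ cong (λ z → (E (1ℚ + c) + E z) - (E c + E (1ℚ + c)) + (ε (suc r) - ε r) + (E c + ε r)) argument ⟩
    (E (1ℚ + c) + E (1ℚ + (1ℚ + c))) - (E c + E (1ℚ + c)) + (ε (suc r) - ε r) + (E c + ε r)
      ≡⟨ cong₂ (λ s t → s + t + (E c + ε r)) (cong₂ _-_ (eulerPoly-+-shift n (1ℚ + c)) (eulerPoly-+-shift n c)) (ε-step r) ⟩
    2ℚ * pow (1ℚ + c) - 2ℚ * pow c + 2ℚ * (pow (2ℚ * ℕ→ℚ (suc r) - 1ℚ) - pow (2ℚ * ℕ→ℚ (suc r))) + (E c + ε r)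
      ≡⟨ cong₂ (λ s t → 2ℚ * pow (1ℚ + c) - 2ℚ * pow c + 2ℚ * (pow s - pow t) + (E c + ε r)) odd-argument even-argument ⟩
    2ℚ * pow (1ℚ + c) - 2ℚ * pow c + 2ℚ * (pow c - pow (1ℚ + c)) + (E c + ε r)
      ≡⟨ cancel (pow (1ℚ + c)) (pow c) (E c + ε r) ⟩
    E c + ε r
      ≡⟨ ε-reflect r ⟩
    0ℚ  ∎
    where
    c : ℚ
    c = 2ℚ * ℕ→ℚ r + 1ℚ
    insert : ∀ x y z s t → x + y ≡ (t + x) - (s + t) + (y - z) + (s + z)
    insert = solve-∀ ring
    cancel : ∀ s t x → 2ℚ * s - 2ℚ * t + 2ℚ * (t - s) + x ≡ x
    cancel = solve-∀ ring
    shift : ∀ ρ → 2ℚ * (1ℚ + ρ) + 1ℚ ≡ 1ℚ + (1ℚ + (2ℚ * ρ + 1ℚ))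
    shift = solve-∀ ring
    shift-odd : ∀ ρ → 2ℚ * (1ℚ + ρ) - 1ℚ ≡ 2ℚ * ρ + 1ℚ
    shift-odd = solve-∀ ring
    shift-even : ∀ ρ → 2ℚ * (1ℚ + ρ) ≡ 1ℚ + (2ℚ * ρ + 1ℚ)
    shift-even = solve-∀ ring
    argument : 2ℚ * ℕ→ℚ (suc r) + 1ℚ ≡ 1ℚ + (1ℚ + c)
    argument = trans (cong (λ z → 2ℚ * z + 1ℚ) (ℕ→ℚ-suc r)) (shift (ℕ→ℚ r))
    odd-argument : 2ℚ * ℕ→ℚ (suc r) - 1ℚ ≡ c
    odd-argument = trans (cong (λ z → 2ℚ * z - 1ℚ) (ℕ→ℚ-suc r)) (shift-odd (ℕ→ℚ r))
    even-argument : 2ℚ * ℕ→ℚ (suc r) ≡ 1ℚ + c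
    even-argument = trans (cong (2ℚ *_) (ℕ→ℚ-suc r)) (shift-even (ℕ→ℚ r))

  -- Integrality of the sum and its ingredients

  integral-sineProduct : ∀ {a} j → j ≤ m → Integral a → Integral (sineProduct j a)
  integral-sineProduct zero    j≤m ia = integral-1
  integral-sineProduct (suc j) j<m ia = integral-* (integral-sineProduct j (ℕₚ.<⇒≤ j<m) ia)
    (integral-- integral-1 (integral-* (integral-* ia ia) (integral-* (integral-recip j<m) (integral-recip j<m))))

  integral-binom : ∀ {x} j → j ≤ m → Integral x → Integral (binom x j)
  integral-binom zero    j≤m ix = integral-1
  integral-binom {x} (suc j) j<m ix = subst Integral (sym (binom-suc x j))
    (integral-* (integral-* (integral-binom j (ℕₚ.<⇒≤ j<m) ix) (integral-- ix (integral-ℕ j))) (integral-recip j<m))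

  integral-inv2km1 : ∀ j → j ≤ m → Integral (inv2km1 j)
  integral-inv2km1 zero    j≤m = integral-neg integral-1
  integral-inv2km1 (suc j) j<m = integral-/ (pos 1) (suc (2 *ℕ j)) (p∤<p (1+2j<p j<m))

  integral-pairSum : ∀ {a} → Integral a → Integral (pairSum m a)
  integral-pairSum ia = integral-sumTo m (λ {j} j≤m → integral-*
    (integral-* (integral-binom j j≤m ia) (integral-binom j j≤m (integral-- (integral-neg integral-1) ia)))
    (integral-inv2km1 j j≤m))

  -- The product and the sum at r + δ modulo p²

  module _ {δ : ℚ} (iδ : Ideal 1 δ) where

    private
      integral-δ : Integral δ
      integral-δ = ideal⇒integral iδ

      predecessor : ∀ r → ℕ→ℚ (suc r) + δ - 1ℚ ≡ ℕ→ℚ r + δ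
      predecessor r = trans (cong (λ z → z + δ - 1ℚ) (ℕ→ℚ-suc r)) (cancel (ℕ→ℚ r) δ)
        where
        cancel : ∀ ρ δ → 1ℚ + ρ + δ - 1ℚ ≡ ρ + δ
        cancel = solve-∀ ring

    sineProduct-near-0 : ∀ j → j ≤ m → Ideal 1 (sineProduct j δ - 1ℚ)
    sineProduct-near-0 zero    j≤m = ideal-0
    sineProduct-near-0 (suc j) j<m = ideal-resp (split (sineProduct j δ) δ (recip j))
      (ideal-- (sineProduct-near-0 j (ℕₚ.<⇒≤ j<m))
        (ideal-*ˡ (integral-* (integral-* (integral-sineProduct j (ℕₚ.<⇒≤ j<m) integral-δ) integral-δ)
                              (integral-* (integral-recip j<m) (integral-recip j<m))) iδ))
      where
      split : ∀ D δ i → D * (1ℚ - δ * δ * (i * i)) - 1ℚ ≡ (D - 1ℚ) - D * δ * (i * i) * δ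
      split = solve-∀ ring

    -- Twice the recurrence of the product, with p = 2m + 1, reads (2r + 1 + 2δ - p) X = (2r + 1 +
    -- 2δ + p) Y for consecutive values Y at r and X at r + 1. Replacing X and Y by X - δ and Y - δ
    -- costs only 2pδ, which lies in p²ℤₚ.
    sineProduct-congruence : ∀ r → r ≤ m → Ideal 2 ((ℕ→ℚ r + δ) * sineProduct m (ℕ→ℚ r + δ) - δ)
    sineProduct-congruence zero    r≤m = ideal-resp
      (trans (cong (λ a → a * sineProduct m a - δ) (ℚ.+-identityˡ δ)) (factor δ (sineProduct m δ)))
      (ideal-* iδ (sineProduct-near-0 m ℕₚ.≤-refl))
      where
      factor : ∀ δ D → δ * D - δ ≡ δ * (D - 1ℚ)
      factor = solve-∀ ring
    sineProduct-congruence (suc r) r<m = ideal-cancel-perturbed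
      (unit-ℕ (2 *ℕ r) (1+2j<p r<m))
      (ideal-- (ideal-*ˡ integral-2 iδ) ideal-q)
      (integral-- (integral-* ia (integral-sineProduct m ℕₚ.≤-refl ia)) integral-δ)
      (ideal-resp identity
        (ideal-+ (ideal-*ˡ (integral-+ (integral-+ (integral-ℕ (suc (2 *ℕ r))) (integral-* integral-2 integral-δ)) (integral-ℕ p))
                           (sineProduct-congruence r (ℕₚ.<⇒≤ r<m)))
                 (ideal-*ˡ integral-2 (ideal-* ideal-q iδ))))
      where
      a b X Y : ℚ
      a = ℕ→ℚ (suc r) + δ
      b = ℕ→ℚ r + δ
      X = a * sineProduct m a
      Y = b * sineProduct m b

      ia : Integral a
      ia = integral-+ (integral-ℕ (suc r)) integral-δ

      recurrence : (ℕ→ℚ m + 1ℚ - a) * X + (ℕ→ℚ m + a) * Y ≡ 0ℚ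
      recurrence = begin
        (ℕ→ℚ m + 1ℚ - a) * X + (ℕ→ℚ m + a) * Y
          ≡⟨ cong₂ (λ s t → s + (ℕ→ℚ m + a) * (t * sineProduct m t)) (sineProduct-recurrence m a) (sym (predecessor r)) ⟩
        - ((ℕ→ℚ m + a) * ((a - 1ℚ) * sineProduct m (a - 1ℚ))) + (ℕ→ℚ m + a) * ((a - 1ℚ) * sineProduct m (a - 1ℚ))
          ≡⟨ ℚ.+-inverseˡ ((ℕ→ℚ m + a) * ((a - 1ℚ) * sineProduct m (a - 1ℚ))) ⟩
        0ℚ  ∎

      -- Here μ stands for m; the subtracted summand is twice the left side of `recurrence` and
      -- vanishes.
      expand : ∀ ρ δ μ X Y → (2ℚ * ρ + 1ℚ + (2ℚ * δ - (2ℚ * μ + 1ℚ))) * (X - δ)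
        ≡ (2ℚ * ρ + 1ℚ + 2ℚ * δ + (2ℚ * μ + 1ℚ)) * (Y - δ) + 2ℚ * ((2ℚ * μ + 1ℚ) * δ)
          - 2ℚ * ((μ + 1ℚ - (1ℚ + ρ + δ)) * X + (μ + (1ℚ + ρ + δ)) * Y)
      expand = solve-∀ ring

      drop : ∀ x → x - 2ℚ * 0ℚ ≡ x
      drop = solve-∀ ring

      identity : (ℕ→ℚ (suc (2 *ℕ r)) + (2ℚ * δ - q)) * (X - δ)
                 ≡ (ℕ→ℚ (suc (2 *ℕ r)) + 2ℚ * δ + q) * (Y - δ) + 2ℚ * (q * δ)
      identity = begin
        (ℕ→ℚ (suc (2 *ℕ r)) + (2ℚ * δ - q)) * (X - δ)
          ≡⟨ cong₂ (λ o s → (o + (2ℚ * δ - s)) * (X - δ)) (ℕ→ℚ-odd r) q≡2m+1 ⟩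
        (2ℚ * ℕ→ℚ r + 1ℚ + (2ℚ * δ - (2ℚ * ℕ→ℚ m + 1ℚ))) * (X - δ)
          ≡⟨ expand (ℕ→ℚ r) δ (ℕ→ℚ m) X Y ⟩
        (2ℚ * ℕ→ℚ r + 1ℚ + 2ℚ * δ + (2ℚ * ℕ→ℚ m + 1ℚ)) * (Y - δ) + 2ℚ * ((2ℚ * ℕ→ℚ m + 1ℚ) * δ)
          - 2ℚ * ((ℕ→ℚ m + 1ℚ - (1ℚ + ℕ→ℚ r + δ)) * X + (ℕ→ℚ m + (1ℚ + ℕ→ℚ r + δ)) * Y)
          ≡⟨ cong₂ (λ o s → (o + 2ℚ * δ + s) * (Y - δ) + 2ℚ * (s * δ) - 2ℚ * ((ℕ→ℚ m + 1ℚ - (1ℚ + ℕ→ℚ r + δ)) * X + (ℕ→ℚ m + (1ℚ + ℕ→ℚ r + δ)) * Y))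
                   (sym (ℕ→ℚ-odd r)) (sym q≡2m+1) ⟩
        (ℕ→ℚ (suc (2 *ℕ r)) + 2ℚ * δ + q) * (Y - δ) + 2ℚ * (q * δ)
          - 2ℚ * ((ℕ→ℚ m + 1ℚ - (1ℚ + ℕ→ℚ r + δ)) * X + (ℕ→ℚ m + (1ℚ + ℕ→ℚ r + δ)) * Y)
          ≡⟨ cong (λ z → (ℕ→ℚ (suc (2 *ℕ r)) + 2ℚ * δ + q) * (Y - δ) + 2ℚ * (q * δ) - 2ℚ * z)
                  (trans (cong (λ z → (ℕ→ℚ m + 1ℚ - (z + δ)) * X + (ℕ→ℚ m + (z + δ)) * Y) (sym (ℕ→ℚ-suc r))) recurrence) ⟩
        (ℕ→ℚ (suc (2 *ℕ r)) + 2ℚ * δ + q) * (Y - δ) + 2ℚ * (q * δ) - 2ℚ * 0ℚ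
          ≡⟨ drop ((ℕ→ℚ (suc (2 *ℕ r)) + 2ℚ * δ + q) * (Y - δ) + 2ℚ * (q * δ)) ⟩
        (ℕ→ℚ (suc (2 *ℕ r)) + 2ℚ * δ + q) * (Y - δ) + 2ℚ * (q * δ)  ∎

    -- To first order in δ the new term is -δ/(κ(2κ - 1)), and modulo p the increment of `ε` is
    -- 1/(κ(2κ - 1)). So the sum telescopes against `ε` and no harmonic sum has to be evaluated.
    pairSum-near-0 : ∀ j → j ≤ m → Ideal 2 (pairSum j δ + 1ℚ + δ * (ε j - ε 0))
    pairSum-near-0 zero    j≤m = ideal-resp (vanish δ (ε 0)) ideal-0
      where
      vanish : ∀ δ x → - 1ℚ + 1ℚ + δ * (x - x) ≡ 0ℚ
      vanish = solve-∀ ring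
    pairSum-near-0 (suc j) j<m = ideal-resp
      (split (pairSum j δ) (binomPair δ (suc j)) w δ (ε (suc j)) (ε j) (ε 0) i)
      (ideal-+ (ideal-+ (pairSum-near-0 j (ℕₚ.<⇒≤ j<m)) (ideal-* iδ g≡iw))
               (ideal-*ˡ (integral-inv2km1 (suc j) j<m) pair≡-δi))
      where
      κ i w D : ℚ
      κ = ℕ→ℚ (suc j)
      i = recip j
      w = inv2km1 (suc j)
      D = sineProduct j δ

      split : ∀ S u w δ ε′ ε ε₀ i → S + u * w + 1ℚ + δ * (ε′ - ε₀)
              ≡ (S + 1ℚ + δ * (ε - ε₀)) + δ * ((ε′ - ε) - i * w) + w * (u + δ * i)
      split = solve-∀ ring

      ii : Integral i
      ii = integral-recip j<m

      g≡iw : Ideal 1 ((ε (suc j) - ε j) - i * w)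
      g≡iw = ideal-resp
        -- Inserting 1 = (κ i)((2κ - 1) w) exposes the product that the division-free congruence for
        -- the increment controls.
        (trans (cong (_- i * w) (trans (sym (ℚ.*-identityˡ (ε (suc j) - ε j)))
                 (sym (cong₂ (λ s t → s * t * (ε (suc j) - ε j)) (*-recip j) (*-inv2km1 j)))))
               (regroup κ (2ℚ * κ - 1ℚ) i w (ε (suc j) - ε j)))
        (ideal-*ˡ (integral-* ii (integral-inv2km1 (suc j) j<m)) (ε-step-congruence j<m))
        where
        regroup : ∀ κ o i w g → κ * i * (o * w) * g - i * w ≡ i * w * (κ * o * g - 1ℚ)
        regroup = solve-∀ ring

      pair≡-δi : Ideal 2 (binomPair δ (suc j) + δ * i)
      pair≡-δi = ideal-resp
        (begin
          binomPair δ (suc j) + δ * i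
            ≡⟨ cong (_+ δ * i) (binomPair-closed δ j) ⟩
          - (δ * D * (δ + κ) * (i * i)) + δ * i
            ≡⟨ expand δ D κ i ⟩
          - (D * (i * i) * (δ * δ)) - D * δ * i * (κ * i) + δ * i
            ≡⟨ cong (λ s → - (D * (i * i) * (δ * δ)) - D * δ * i * s + δ * i) (*-recip j) ⟩
          - (D * (i * i) * (δ * δ)) - D * δ * i * 1ℚ + δ * i
            ≡⟨ collect δ D i ⟩
          - (D * (i * i) * (δ * δ)) - i * (δ * (D - 1ℚ))  ∎)
        (ideal-- (ideal-neg (ideal-*ˡ (integral-* (integral-sineProduct j (ℕₚ.<⇒≤ j<m) integral-δ) (integral-* ii ii)) (ideal-* iδ iδ)))
                 (ideal-*ˡ ii (ideal-* iδ (sineProduct-near-0 j (ℕₚ.<⇒≤ j<m)))))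
        where
        expand : ∀ δ D κ i → - (δ * D * (δ + κ) * (i * i)) + δ * i ≡ - (D * (i * i) * (δ * δ)) - D * δ * i * (κ * i) + δ * i
        expand = solve-∀ ring
        collect : ∀ δ D i → - (D * (i * i) * (δ * δ)) - D * δ * i * 1ℚ + δ * i ≡ - (D * (i * i) * (δ * δ)) - i * (δ * (D - 1ℚ))
        collect = solve-∀ ring

    -- The form with 2r + 1 in place of 2a + 1 contains no hidden δ, which suits the induction. In
    -- the passage to a = r + δ the difference 2δ is what the summand 1 next to the Euler polynomial
    -- accounts for.
    pairSum-congruence : ∀ r → r ≤ m →
      Ideal 2 (pairSum m (ℕ→ℚ r + δ) + (2ℚ * ℕ→ℚ r + 1ℚ) - 2ℚ * δ * (2ℚ * ℕ→ℚ r + 1ℚ) * ε r)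
    pairSum-congruence zero    r≤m = ideal-resp
      (trans (cong (λ a → pairSum m a + (2ℚ * 0ℚ + 1ℚ) - 2ℚ * δ * (2ℚ * 0ℚ + 1ℚ) * ε 0) (ℚ.+-identityˡ δ))
             (split (pairSum m δ) δ (ε m) (ε 0)))
      (ideal-- (pairSum-near-0 m ℕₚ.≤-refl) (ideal-* iδ ε-last))
      where
      split : ∀ S δ ε ε₀ → S + (2ℚ * 0ℚ + 1ℚ) - 2ℚ * δ * (2ℚ * 0ℚ + 1ℚ) * ε₀ ≡ (S + 1ℚ + δ * (ε - ε₀)) - δ * (ε + ε₀)
      split = solve-∀ ring
    pairSum-congruence (suc r) r<m = ideal-cancel-perturbed
      -- The multiplier is κ(2a - 1) = κ(2κ - 1) + 2κδ: a unit plus a multiple of p. The additional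
      -- κ clears the denominator of the increment of `ε`.
      (unit-* uκ (subst Unit (sym (2κ-1≡odd r)) (unit-ℕ (2 *ℕ r) (1+2j<p r<m))))
      (ideal-*ˡ (integral-* iκ integral-2) iδ)
      (integral-- (integral-+ (integral-pairSum ia) i2κ+1)
                  (integral-* (integral-* (integral-* integral-2 integral-δ) i2κ+1) (integral-ε (suc r))))
      (ideal-resp identity
        (ideal-+
          (ideal-- (ideal-+ (ideal-*ˡ (integral-* (integral-+ (integral-* integral-2 ia) integral-1) iκ) previous)
                            (ideal-*ˡ integral-2 κD≡δ))
                   (ideal-*ˡ (integral-* integral-2 i2κ+1) (ideal-* iδ (ε-step-congruence r<m))))
          (ideal-*ˡ (integral-* (integral-* (integral-ℕ 4) iκ)
                      (integral-- (integral-* (integral-2x-1 iκ) (integral-ε r)) (integral-* i2κ+1 (integral-ε (suc r)))))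
                    (ideal-* iδ iδ))))
      where
      κ a S S′ D : ℚ
      κ  = ℕ→ℚ (suc r)
      a  = κ + δ
      S  = pairSum m a
      S′ = pairSum m (a - 1ℚ)
      D  = sineProduct m a

      uκ : Unit κ
      uκ = unit-ℕ r (1+j<p r<m)

      iκ : Integral κ
      iκ = integral-ℕ (suc r)

      i2κ+1 : Integral (2ℚ * κ + 1ℚ)
      i2κ+1 = integral-+ (integral-* integral-2 iκ) integral-1

      ia : Integral a
      ia = integral-+ iκ integral-δ

      iD : Integral D
      iD = integral-sineProduct m ℕₚ.≤-refl ia

      -- The known congruence has (κ + δ) D. It forces p to divide D, because κ is a unit, and then
      -- δ D is negligible modulo p².
      κD≡δ : Ideal 2 (κ * D - δ)
      κD≡δ = ideal-resp (split κ δ D) (ideal-- W≡δ (ideal-* iδ D≡0))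
        where
        split : ∀ κ δ D → κ * D - δ ≡ ((κ + δ) * D - δ) - δ * D
        split = solve-∀ ring
        split′ : ∀ κ δ D → κ * D ≡ ((κ + δ) * D - δ) - (D - 1ℚ) * δ
        split′ = solve-∀ ring
        W≡δ : Ideal 2 ((κ + δ) * D - δ)
        W≡δ = sineProduct-congruence (suc r) r<m
        D≡0 : Ideal 1 D
        D≡0 = ideal-cancel uκ (ideal-resp (split′ κ δ D)
          (ideal-- (ideal-weaken W≡δ) (ideal-*ˡ (integral-- iD integral-1) iδ)))

      previous : Ideal 2 (S′ + (2ℚ * κ - 1ℚ) - 2ℚ * δ * (2ℚ * κ - 1ℚ) * ε r)
      previous = ideal-resp
        (cong₂ (λ b o → pairSum m b + o - 2ℚ * δ * o * ε r) (predecessor r) (trans (2κ-1≡odd r) (ℕ→ℚ-odd r)))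
        (pairSum-congruence r (ℕₚ.<⇒≤ r<m))

      -- The last summand is κ times the defect of the recurrence for the sum, hence zero. The one
      -- with δ² collects the products of the 2δ from the multipliers with the Euler terms, which
      -- are already of first order.
      expand : ∀ κ δ S S′ D ε ε′ →
        (κ * (2ℚ * κ - 1ℚ) + κ * 2ℚ * δ) * (S + (2ℚ * κ + 1ℚ) - 2ℚ * δ * (2ℚ * κ + 1ℚ) * ε)
        ≡ (2ℚ * (κ + δ) + 1ℚ) * κ * (S′ + (2ℚ * κ - 1ℚ) - 2ℚ * δ * (2ℚ * κ - 1ℚ) * ε′)
          + 2ℚ * (κ * D - δ)
          - 2ℚ * (2ℚ * κ + 1ℚ) * (δ * (κ * (2ℚ * κ - 1ℚ) * (ε - ε′) - 1ℚ))
          + ℕ→ℚ 4 * κ * ((2ℚ * κ - 1ℚ) * ε′ - (2ℚ * κ + 1ℚ) * ε) * (δ * δ)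
          + κ * (((2ℚ * (κ + δ) - 1ℚ) * S - (2ℚ * (κ + δ) + 1ℚ) * S′) - 2ℚ * D)
      expand = solve-∀ ring

      drop : ∀ x κ y → x + κ * (y - y) ≡ x
      drop = solve-∀ ring

      identity : (κ * (2ℚ * κ - 1ℚ) + κ * 2ℚ * δ) * (S + (2ℚ * κ + 1ℚ) - 2ℚ * δ * (2ℚ * κ + 1ℚ) * ε (suc r))
        ≡ (2ℚ * a + 1ℚ) * κ * (S′ + (2ℚ * κ - 1ℚ) - 2ℚ * δ * (2ℚ * κ - 1ℚ) * ε r)
          + 2ℚ * (κ * D - δ)
          - 2ℚ * (2ℚ * κ + 1ℚ) * (δ * (κ * (2ℚ * κ - 1ℚ) * (ε (suc r) - ε r) - 1ℚ))
          + ℕ→ℚ 4 * κ * ((2ℚ * κ - 1ℚ) * ε r - (2ℚ * κ + 1ℚ) * ε (suc r)) * (δ * δ)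
      identity = trans (expand κ δ S S′ D (ε (suc r)) (ε r))
        (trans (cong (λ z → (2ℚ * a + 1ℚ) * κ * (S′ + (2ℚ * κ - 1ℚ) - 2ℚ * δ * (2ℚ * κ - 1ℚ) * ε r)
                 + 2ℚ * (κ * D - δ)
                 - 2ℚ * (2ℚ * κ + 1ℚ) * (δ * (κ * (2ℚ * κ - 1ℚ) * (ε (suc r) - ε r) - 1ℚ))
                 + ℕ→ℚ 4 * κ * ((2ℚ * κ - 1ℚ) * ε r - (2ℚ * κ + 1ℚ) * ε (suc r)) * (δ * δ)
                 + κ * (z - 2ℚ * D)) (pairSum-recurrence m a))
               (drop _ κ (2ℚ * D)))

  -- Residues below and above p/2

  integral-b : ∀ {a} → Integral a → Integral (2ℚ * a + 1ℚ)
  integral-b ia = integral-+ (integral-* integral-2 ia) integral-1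

  integral-E[-2a] : ∀ {a} → Integral a → Integral (E (- (2ℚ * a)))
  integral-E[-2a] ia = integral-E (integral-neg (integral-* integral-2 ia))

  r<p/2⇒r≤m : ∀ {r} → 2 *ℕ r < p → r ≤ m
  r<p/2⇒r≤m {r} 2r<p = ℕₚ.*-cancelˡ-≤ 2 (ℕₚ.≤-trans (ℕ.s≤s⁻¹ 2r<p) (ℕₚ.≤-reflexive (sym (ℕₚ.*-suc 2 k))))

  -- With δ = a - r one has -(2a + 1) + 2δ = -(2r + 1). In the term that carries E, both 2a + 1 and
  -- E(-2a) may be replaced by their values at r, since δ multiplies them.
  small-residue : ∀ {a} r → Integral a → 2 *ℕ r < p → Ideal 1 (a - ℕ→ℚ r) →
    let b = 2ℚ * a + 1ℚ
        X = 1ℚ + b * E (- (2ℚ * a))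
    in Ideal 2 (pairSum m a - (- b + 2ℚ * (a - ℕ→ℚ r) * X))
  small-residue {a} r ia 2r<p iδ = ideal-resp
    (trans (cong (λ z → pairSum m z - (- (2ℚ * a + 1ℚ) + 2ℚ * δ * (1ℚ + (2ℚ * a + 1ℚ) * E (- (2ℚ * a))))) a≡ρ+δ)
           (split a ρ (pairSum m (ρ + δ)) (E (- (2ℚ * a))) (ε r)))
    (ideal-- (ideal-- (pairSum-congruence iδ r (r<p/2⇒r≤m 2r<p))
                      (ideal-*ˡ (integral-* integral-2 (integral-b (integral-ℕ r))) (ideal-* iδ E≡ε)))
             (ideal-*ˡ (integral-* (integral-ℕ 4) (integral-E[-2a] ia)) (ideal-* iδ iδ)))
    where
    ρ δ : ℚ
    ρ = ℕ→ℚ r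
    δ = a - ρ

    a≡ρ+δ : a ≡ ρ + (a - ρ)
    a≡ρ+δ = recover a ρ
      where
      recover : ∀ a ρ → a ≡ ρ + (a - ρ)
      recover = solve-∀ ring

    E≡ε : Ideal 1 (E (- (2ℚ * a)) - ε r)
    E≡ε = E-congruent (integral-neg (integral-* integral-2 ia)) (integral-neg (integral-* integral-2 (integral-ℕ r)))
      (ideal-resp (double a ρ) (ideal-*ˡ (integral-neg integral-2) iδ))
      where
      double : ∀ a ρ → - (2ℚ * a) - - (2ℚ * ρ) ≡ - 2ℚ * (a - ρ)
      double = solve-∀ ring

    split : ∀ a ρ S E ε → S - (- (2ℚ * a + 1ℚ) + 2ℚ * (a - ρ) * (1ℚ + (2ℚ * a + 1ℚ) * E))
            ≡ (S + (2ℚ * ρ + 1ℚ) - 2ℚ * (a - ρ) * (2ℚ * ρ + 1ℚ) * ε)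
              - 2ℚ * (2ℚ * ρ + 1ℚ) * ((a - ρ) * (E - ε)) - ℕ→ℚ 4 * E * ((a - ρ) * (a - ρ))
    split = solve-∀ ring

  -- Reduces to a small residue by a ↦ -1 - a, which sends r to s = p - 1 - r.
  large-residue : ∀ {a} r → r < p → Integral a → p < 2 *ℕ r → Ideal 1 (a - ℕ→ℚ r) →
    let b = 2ℚ * a + 1ℚ
        X = 1ℚ + b * E (- (2ℚ * a))
    in Ideal 2 (pairSum m a - (b + 2ℚ * (q + a - ℕ→ℚ r) * X))
  large-residue {a} r (s≤s r≤2m) ia p<2r iδ = ideal-resp
    (trans (cong₂ (λ S z → S - (2ℚ * a + 1ℚ + 2ℚ * (z + a - ρ) * (1ℚ + (2ℚ * a + 1ℚ) * e)))
              (trans (sym (pairSum-reflect m a)) (cong (pairSum m) (recover (- 1ℚ - a) σ))) q≡)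
           (split a ρ σ (pairSum m (σ + δ)) e (ε s) (pow (2ℚ * σ + 1ℚ))))
    (ideal-- (ideal-- (pairSum-congruence iδ′ s (ℕₚ.<⇒≤ s<m))
                      (ideal-*ˡ integral-2 (ideal-* iδ′ bracket)))
             (ideal-*ˡ (integral-* (integral-ℕ 4) (integral-E[-2a] ia)) (ideal-* iδ′ iδ′)))
    where
    s : ℕ
    s = suc (suc (2 *ℕ k)) ∸ r

    s+r : s +ℕ r ≡ suc (suc (2 *ℕ k))
    s+r = ℕₚ.m∸n+n≡m r≤2m

    m<r : m < r
    m<r = ℕₚ.*-cancelˡ-< 2 m r (ℕₚ.<-trans (ℕₚ.≤-reflexive (cong suc (ℕₚ.*-suc 2 k))) p<2r)

    -- Strictness matters: at s = m the number 2s + 1, which has to be inverted below, would be p.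
    s<m : s < m
    s<m = ℕₚ.+-cancelʳ-< r s m (subst (_< m +ℕ r) m+m≡s+r (ℕₚ.+-monoʳ-< m m<r))
      where
      m+m≡s+r : m +ℕ m ≡ s +ℕ r
      m+m≡s+r = trans (cong (m +ℕ_) (sym (ℕₚ.+-identityʳ m))) (trans (ℕₚ.*-suc 2 k) (sym s+r))

    ρ σ δ e : ℚ
    ρ = ℕ→ℚ r
    σ = ℕ→ℚ s
    δ = - 1ℚ - a - σ
    e = E (- (2ℚ * a))

    recover : ∀ a ρ → a ≡ ρ + (a - ρ)
    recover = solve-∀ ring

    q≡ : q ≡ 1ℚ + (σ + ρ)
    q≡ = trans (cong (ℕ→ℚ ∘ suc) (sym s+r)) (trans (ℕ→ℚ-suc (s +ℕ r)) (cong (1ℚ +_) (ℕ→ℚ-+ s r)))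

    -- This δ is -(p + a - r), the negative of the factor in the claim.
    iδ′ : Ideal 1 δ
    iδ′ = ideal-resp (trans (reflect a ρ σ) (cong (λ z → - (a - ρ) - z) (sym q≡))) (ideal-- (ideal-neg iδ) ideal-q)
      where
      reflect : ∀ a ρ σ → - 1ℚ - a - σ ≡ - (a - ρ) - (1ℚ + (σ + ρ))
      reflect = solve-∀ ring

    i2σ+1 : Integral (2ℚ * σ + 1ℚ)
    i2σ+1 = integral-b (integral-ℕ s)

    -- Modulo p the argument -2a is 2s + 2 rather than -2s; one shift leads down to 2s + 1, and the
    -- reflection from there to -2s.
    E-shifted : E (1ℚ + (2ℚ * σ + 1ℚ)) ≡ 2ℚ * pow (2ℚ * σ + 1ℚ) + ε s
    E-shifted = begin
      E (1ℚ + o)                               ≡⟨ insert (E o) (E (1ℚ + o)) (ε s) ⟩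
      E o + E (1ℚ + o) - (E o + ε s) + ε s     ≡⟨ cong₂ (λ x y → x - y + ε s) (eulerPoly-+-shift n o) (ε-reflect s) ⟩
      2ℚ * pow o - 0ℚ + ε s                    ≡⟨ cong (_+ ε s) (ℚ.+-identityʳ (2ℚ * pow o)) ⟩
      2ℚ * pow o + ε s                         ∎
      where
      o : ℚ
      o = 2ℚ * σ + 1ℚ
      insert : ∀ x y z → y ≡ x + y - (x + z) + z
      insert = solve-∀ ring

    e≡ : Ideal 1 (e - (2ℚ * pow (2ℚ * σ + 1ℚ) + ε s))
    e≡ = ideal-resp (cong (λ z → e - z) (sym E-shifted))
      (E-congruent (integral-neg (integral-* integral-2 ia)) (integral-+ integral-1 i2σ+1)
        (ideal-resp (double a σ) (ideal-*ˡ integral-2 iδ′)))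
      where
      double : ∀ a σ → - (2ℚ * a) - (1ℚ + (2ℚ * σ + 1ℚ)) ≡ 2ℚ * (- 1ℚ - a - σ)
      double = solve-∀ ring

    -- The powers cancel and leave (2σ + 1) e - 2 - (2σ + 1) ε. Thus 1 - (2σ + 1) e ≡ -1 - (2σ + 1)
    -- ε, and the change of sign of the 1 matches the opposite sign of 2a + 1 in this case.
    bracket : Ideal 1 (2ℚ * ((2ℚ * σ + 1ℚ) * pow (2ℚ * σ + 1ℚ) - 1ℚ)
                       + (2ℚ * σ + 1ℚ) * (e - (2ℚ * pow (2ℚ * σ + 1ℚ) + ε s)))
    bracket = ideal-+
      (ideal-*ˡ integral-2 (subst (λ o → Ideal 1 (o * pow o - 1ℚ)) (ℕ→ℚ-odd s) (pow-inverse (2 *ℕ s) (1+2j<p s<m))))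
      (ideal-*ˡ i2σ+1 e≡)

    split : ∀ a ρ σ S e ε h → S - (2ℚ * a + 1ℚ + 2ℚ * (1ℚ + (σ + ρ) + a - ρ) * (1ℚ + (2ℚ * a + 1ℚ) * e))
            ≡ (S + (2ℚ * σ + 1ℚ) - 2ℚ * (- 1ℚ - a - σ) * (2ℚ * σ + 1ℚ) * ε)
              - 2ℚ * ((- 1ℚ - a - σ) * (2ℚ * ((2ℚ * σ + 1ℚ) * h - 1ℚ) + (2ℚ * σ + 1ℚ) * (e - (2ℚ * h + ε))))
              - ℕ→ℚ 4 * e * ((- 1ℚ - a - σ) * (- 1ℚ - a - σ))
    split = solve-∀ ring

  [p∸1]/2≡m : (p ∸ 1) / 2 ≡ m
  [p∸1]/2≡m = trans (cong (_/ 2) (sym (ℕₚ.*-suc 2 k))) (2*k/2≡k m)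

  pairSum-CongMod : ∀ a x → Ideal 2 (pairSum m a - x) → CongMod p 2 (pairSum ((p ∸ 1) / 2) a) x
  pairSum-CongMod a x (ideal t it eq) =
    subst (λ h → CongMod p 2 (pairSum h a) x) (sym [p∸1]/2≡m) (t , inZp it , eq)

  CongMod⇒ideal : ∀ {j} x y → CongMod p j x y → Ideal j (x - y)
  CongMod⇒ideal x y (t , it , eq) = ideal t (integral it) eq

-- From p = 2k + 3 back to an arbitrary prime p > 3

prime>3⇒odd : ∀ {p} → Prime p → 3 < p → Σ ℕ (λ k → p ≡ suc (suc (suc (2 *ℕ k))))
prime>3⇒odd {p} p-prime 3<p with half p
... | even j with Prime.prime⇒irreducible p-prime (ℕ.m∣m*n {2} j)
...   | inj₁ ()
...   | inj₂ 2≡p = contradiction (subst (3 <_) (sym 2≡p) 3<p) λ { (s≤s (s≤s ())) }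
prime>3⇒odd p-prime (s≤s ()) | odd zero
prime>3⇒odd p-prime 3<p      | odd (suc k) = k , cong suc (ℕₚ.*-suc 2 k)

-- The equation for p is matched while p is still a variable, so that p - 2 reduces to the odd
-- degree used above.
pairSum-small-residue : ∀ {p} k → p ≡ suc (suc (suc (2 *ℕ k))) → Prime p →
  ∀ a → InZp p a → ∀ r → CongMod p 1 a (ℕ→ℚ r) → 2 *ℕ r < p →
  CongMod p 2 (pairSum ((p ∸ 1) / 2) a)
    (- (2ℚ * a + 1ℚ) + 2ℚ * (a - ℕ→ℚ r) * (1ℚ + (2ℚ * a + 1ℚ) * eulerPoly (p ∸ 2) (- (2ℚ * a))))
pairSum-small-residue k refl p-prime a a∈Zp r a≡r 2r<p =
  pairSum-CongMod a _ (small-residue r (integral a∈Zp) 2r<p (CongMod⇒ideal a (ℕ→ℚ r) a≡r))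
  where
  open Integrality (suc (suc (suc (2 *ℕ k)))) p-prime
  open OddPrime k p-prime hiding (p)

pairSum-large-residue : ∀ {p} k → p ≡ suc (suc (suc (2 *ℕ k))) → Prime p →
  ∀ a → InZp p a → ∀ r → r < p → CongMod p 1 a (ℕ→ℚ r) → p < 2 *ℕ r →
  CongMod p 2 (pairSum ((p ∸ 1) / 2) a)
    (2ℚ * a + 1ℚ + 2ℚ * (ℕ→ℚ p + a - ℕ→ℚ r) * (1ℚ + (2ℚ * a + 1ℚ) * eulerPoly (p ∸ 2) (- (2ℚ * a))))
pairSum-large-residue k refl p-prime a a∈Zp r r<p a≡r p<2r =
  pairSum-CongMod a _ (large-residue r r<p (integral a∈Zp) p<2r (CongMod⇒ideal a (ℕ→ℚ r) a≡r))
  where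
  open Integrality (suc (suc (suc (2 *ℕ k)))) p-prime
  open OddPrime k p-prime hiding (p)

theorem4p2 : (p : ℕ) → Prime p → 3 < p →
    (a : ℚ) → InZp p a → ¬ CongMod p 1 a 0ℚ →
    (r : ℕ) → r < p → CongMod p 1 a (ℕ→ℚ r) →
    let S = sumTo ((p ∸ 1) / 2) (λ k → binom a k * binom (- 1ℚ - a) k * inv2km1 k)
        b = ℕ→ℚ 2 * a + 1ℚ
        X = 1ℚ + b * eulerPoly (p ∸ 2) (- (ℕ→ℚ 2 * a))
    in (2 *ℕ r < p → CongMod p 2 S (- b + ℕ→ℚ 2 * (a - ℕ→ℚ r) * X))
       × (p < 2 *ℕ r → CongMod p 2 S (b + ℕ→ℚ 2 * (ℕ→ℚ p + a - ℕ→ℚ r) * X))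
theorem4p2 p p-prime 3<p a a∈Zp _ r r<p a≡r =
    pairSum-small-residue k p≡ p-prime a a∈Zp r a≡r
  , pairSum-large-residue k p≡ p-prime a a∈Zp r r<p a≡r
  where
  k : ℕ
  k = proj₁ (prime>3⇒odd p-prime 3<p)
  p≡ : p ≡ suc (suc (suc (2 *ℕ k)))
  p≡ = proj₂ (prime>3⇒odd p-prime 3<p)
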